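{- Let $a,b,r$ be integers with $r\ge1$ and $b\ge a\ge 1$, and let $G$ be a connected graph of order $n\ge4(a+b+r+1)$ with minimum degree $\delta(G)\ge a+r$. If $$e(G)\ge \binom{n-r-b-1}{2}+r(n-r)+a(b+1)+a,$$ then $G$ is fractional $ID$-$[a,b]$-factor-critical (with respect to $r$).
   Context: All graphs are finite, simple and undirected. $e(G)$ denotes the number of edges of $G$. For positive integers $a\le b$, a graph $G$ has a fractional $[a,b]$-factor if there is a function $h: E(G)\to[0,1]$ such that $a\le \sum_{e\ni v} h(e)\le b$ for every $v\in V(G)$ (the sum is over edges incident with $v$). For an integer $r\ge 1$, $G$ is fractional $ID$-$[a,b]$-factor-critical (with respect to $r$) if for every independent set $I$ of $G$ with $|I|=r$, the graph $G-I$ has a fractional $[a,b]$-factor. -}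

module Defs where

open import Data.Fin as Fin using (Fin)
import Data.Fin.Properties as Fin
open import Data.Fin.Subset using (Subset; _∈_; ∣_∣)
open import Data.Fin.Subset.Properties using (_∈?_)
open import Data.Integer using (+_)
open import Data.List using (List; []; _∷_; length; lookup; filter; map; foldr; allFin; cartesianProduct)
open import Data.List.Extrema.Nat using (min)
open import Data.Nat as ℕ using (ℕ; _≥_; _⊔_)
import Data.Nat.Properties as ℕ
open import Data.Product using (_×_; _,_; ∃-syntax; proj₁; proj₂)
open import Data.Rational as ℚ using (ℚ; 0ℚ; ½)
import Data.Rational.Properties as ℚ
open import Data.Rational.Solver using (module +-*-Solver)
open import Data.Sum using (_⊎_)
open import Level using (0ℓ)
open import Relation.Binary using (Rel; Decidable; Symmetric; Irreflexive)
open import Relation.Binary.Construct.Closure.ReflexiveTransitive using (Star)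
open import Relation.Binary.PropositionalEquality using (_≡_; refl; sym; cong; subst)
open import Relation.Nullary using (Dec; ¬_; ¬?; _×-dec_; _⊎-dec_)

-- The standard library has no real numbers.  A real is represented by a
-- Cauchy sequence of rationals; _≤ℝ_ is the order of the limits, so two
-- sequences denote the same real exactly when each is _≤ℝ_ the other.

record ℝ : Set where
  field
    seq    : ℕ → ℚ
    cauchy : ∀ ε → 0ℚ ℚ.< ε →
             ∃[ N ] (∀ m n → m ≥ N → n ≥ N → ℚ.∣ seq m ℚ.- seq n ∣ ℚ.≤ ε)

open ℝ public

infix  4 _≤ℝ_
infixl 6 _+ℝ_

_≤ℝ_ : Rel ℝ 0ℓ
x ≤ℝ y = ∀ ε → 0ℚ ℚ.< ε → ∃[ N ] (∀ n → n ≥ N → seq x n ℚ.≤ seq y n ℚ.+ ε)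

fromℚ : ℚ → ℝ
fromℚ q .seq _ = q
fromℚ q .cauchy ε 0<ε = 0 , λ _ _ _ _ →
  subst (λ d → ℚ.∣ d ∣ ℚ.≤ ε) (sym (ℚ.+-inverseʳ q)) (ℚ.<⇒≤ 0<ε)

fromℕ : ℕ → ℝ
fromℕ n = fromℚ ((+ n) ℚ./ 1)

_+ℝ_ : ℝ → ℝ → ℝ
(x +ℝ y) .seq n = seq x n ℚ.+ seq y n
(x +ℝ y) .cauchy ε 0<ε
  with cauchy x (½ ℚ.* ε) 0<½ε | cauchy y (½ ℚ.* ε) 0<½ε
  where
  0<½ε : 0ℚ ℚ.< ½ ℚ.* ε
  0<½ε = subst (ℚ._< ½ ℚ.* ε) (ℚ.*-zeroʳ ½) (ℚ.*-monoʳ-<-pos ½ 0<ε)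
... | M , cx | N , cy = M ⊔ N , λ m n m≥ n≥ → begin
  ℚ.∣ (seq x m ℚ.+ seq y m) ℚ.- (seq x n ℚ.+ seq y n) ∣
    ≡⟨ cong ℚ.∣_∣ (regroup (seq x m) (seq y m) (seq x n) (seq y n)) ⟩
  ℚ.∣ (seq x m ℚ.- seq x n) ℚ.+ (seq y m ℚ.- seq y n) ∣
    ≤⟨ ℚ.∣p+q∣≤∣p∣+∣q∣ (seq x m ℚ.- seq x n) (seq y m ℚ.- seq y n) ⟩
  ℚ.∣ seq x m ℚ.- seq x n ∣ ℚ.+ ℚ.∣ seq y m ℚ.- seq y n ∣
    ≤⟨ ℚ.+-mono-≤ (cx m n (ℕ.m⊔n≤o⇒m≤o M N m≥) (ℕ.m⊔n≤o⇒m≤o M N n≥))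
                  (cy m n (ℕ.m⊔n≤o⇒n≤o M N m≥) (ℕ.m⊔n≤o⇒n≤o M N n≥)) ⟩
  ½ ℚ.* ε ℚ.+ ½ ℚ.* ε
    ≡⟨ ℚ.*-distribʳ-+ ε ½ ½ ⟨
  (½ ℚ.+ ½) ℚ.* ε
    ≡⟨ ℚ.*-identityˡ ε ⟩
  ε ∎
  where
  open ℚ.≤-Reasoning
  open +-*-Solver
  regroup : ∀ p q r s → (p ℚ.+ q) ℚ.- (r ℚ.+ s) ≡ (p ℚ.- r) ℚ.+ (q ℚ.- s)
  regroup = solve 4 (λ p q r s → (p :+ q) :- (r :+ s) := (p :- r) :+ (q :- s)) refl

sumℝ : List ℝ → ℝ
sumℝ = foldr _+ℝ_ (fromℕ 0)

record Graph (n : ℕ) : Set₁ where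
  infix 4 _∼_ _∼?_
  field
    _∼_      : Rel (Fin n) 0ℓ
    _∼?_     : Decidable _∼_
    ∼-sym    : Symmetric _∼_
    ∼-irrefl : Irreflexive _≡_ _∼_

module _ {n : ℕ} (G : Graph n) where
  open Graph G

  -- Each edge {u,v} is listed once, as the pair (u , v) with u < v.
  edges : List (Fin n × Fin n)
  edges = filter (λ (u , v) → (u Fin.<? v) ×-dec (u ∼? v))
                 (cartesianProduct (allFin n) (allFin n))

  e : ℕ
  e = length edges

  -- E(G) as a type: the positions in the list of edges.
  Edge : Set
  Edge = Fin e

  Incident : Fin n → Edge → Set
  Incident v x = v ≡ proj₁ (lookup edges x) ⊎ v ≡ proj₂ (lookup edges x)

  incident? : ∀ v x → Dec (Incident v x)
  incident? v x = (v Fin.≟ proj₁ (lookup edges x)) ⊎-dec (v Fin.≟ proj₂ (lookup edges x))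

  degree : Fin n → ℕ
  degree v = length (filter (v ∼?_) (allFin n))

  -- Every degree is below n, so the default value n plays no role when n > 0.
  δ : ℕ
  δ = min n (map degree (allFin n))

  -- For n > 0; the empty graph also satisfies this.
  Connected : Set
  Connected = ∀ u v → Star _∼_ u v

  Independent : Subset n → Set
  Independent I = ∀ {u v} → u ∈ I → v ∈ I → ¬ (u ∼ v)

  -- The subgraph induced by the listed vertices, relabelled by their positions
  -- in the list (which is meant to be free of repetitions).
  induced : (vs : List (Fin n)) → Graph (length vs)
  induced vs = record
    { _∼_      = λ i j → lookup vs i ∼ lookup vs j
    ; _∼?_     = λ i j → lookup vs i ∼? lookup vs j
    ; ∼-sym    = ∼-sym
    ; ∼-irrefl = λ i≡j → ∼-irrefl (cong (lookup vs) i≡j)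
    }

  weightAt : (Edge → ℝ) → Fin n → ℝ
  weightAt h v = sumℝ (map h (filter (incident? v) (allFin e)))

  HasFractionalFactor : ℕ → ℕ → Set
  HasFractionalFactor a b = ∃[ h ]
    (∀ x → fromℕ 0 ≤ℝ h x × h x ≤ℝ fromℕ 1) ×
    (∀ v → fromℕ a ≤ℝ weightAt h v × weightAt h v ≤ℝ fromℕ b)

outside : ∀ {n} → Subset n → List (Fin n)
outside I = filter (λ v → ¬? (v ∈? I)) (allFin _)

infixl 6 _-_

_-_ : ∀ {n} (G : Graph n) (I : Subset n) → Graph (length (outside I))
G - I = induced G (outside I)

FractionalIDCritical : ∀ {n} → ℕ → ℕ → ℕ → Graph n → Set
FractionalIDCritical a b r G =
  ∀ I → Independent G I → ∣ I ∣ ≡ r → HasFractionalFactor (G - I) a b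

-- A 0-1 matrix f below the adjacency matrix of H whose row and column sums
-- all lie in [a,b] yields the fractional factor h(xy) = (f x y + f y x) / 2.
-- If a row (or, transposing f, a column) has sum below a, search along
-- alternating walks from it: either a row with sum above a or a column with
-- sum below b is reached, and switching the walk lowers the total deficit, or
-- the reachable rows R and the columns C adjacent to them outside f satisfy b
-- |C| + e(R, V \ C) < a |R|.  For H = G - I the latter contradicts the number
-- of edges: with S = C \ R, T = R \ C, s = |S|, t = |T| and D = e(T, V \ S)
-- one gets b s + D < a t ≤ D + s t, hence t > b, while 2 e(H) is at most (m -
-- t)(m - t - 1) + 2 (D + s t), too small when m ≥ 4a + 4b + 7.

module Submission where

open import Defs
open import Data.Bool using (Bool; true; false; not; _∧_; _∨_; if_then_else_)
import Data.Bool.Properties as Bool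
open import Data.Empty using (⊥)
open import Data.Fin using (Fin; zero; suc; _≟_; _<?_)
import Data.Fin.Properties as Fin
open import Data.Fin.Properties using (any?)
open import Data.Fin.Subset using (Subset; ∣_∣)
open import Data.Fin.Subset.Properties using (_∈?_)
import Data.Integer as ℤ
open import Data.Integer using () renaming (+_ to pos)
import Data.Integer.Properties as ℤ
open import Data.Integer.Tactic.RingSolver using () renaming (solve-∀ to ℤ-solve-∀)
open import Data.List using (List; []; _∷_; _++_; length; lookup; filter; map; allFin; cartesianProduct; tabulate)
open import Data.List.Extrema.Nat using (min≤xs)
open import Data.List.Membership.Propositional.Properties using (∈-allFin; ∈-map⁺)
open import Data.List.Properties using (map-∘; map-++; map-tabulate)
import Data.List.Relation.Unary.All as All
open import Data.Nat using (ℕ; zero; suc; _+_; _*_; _∸_; _≤_; _<_; _≥_; z≤n; s≤s)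
open import Data.Nat.Combinatorics using (_C_; nC1≡n; nCk+nC[k+1]≡[n+1]C[k+1])
open import Data.Nat.Induction using (<-wellFounded)
import Data.Nat.ListAction as List
open import Data.Nat.ListAction.Properties using (sum-++)
open import Data.Nat.Properties hiding (_≟_; _<?_)
import Data.Nat.Properties as ℕ
open import Data.Nat.Tactic.RingSolver using (solve-∀)
open import Data.Product using (_×_; _,_; ∃-syntax; proj₁; proj₂; uncurry)
open import Data.Rational as ℚ using (ℚ; fromℚᵘ; toℚᵘ)
import Data.Rational.Properties as ℚ
open import Data.Rational.Unnormalised as ℚᵘ using (mkℚᵘ; *≡*; *≤*)
import Data.Rational.Unnormalised.Properties as ℚᵘ
open import Data.Sum using (_⊎_; inj₁; inj₂)
open import Data.Vec using ([]; _∷_)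
open import Function using (flip; _∘_; mk⇔)
open import Induction.WellFounded using (Acc; acc)
open import Level using (0ℓ)
open import Relation.Binary using (tri<; tri≈; tri>)
open import Relation.Binary.PropositionalEquality
open import Relation.Nullary using (Dec; yes; no; does; ¬_; ¬?; _×-dec_; contradiction)
open import Relation.Nullary.Decidable using (dec-true; dec-false; does-⇔)
open import Relation.Unary using (Pred; Decidable)

open import Algebra.Properties.Semiring.Sum +-*-semiring using (sum; ∑-distrib-+; ∑-comm; sum-cong-≗; *-distribˡ-sum; *-distribʳ-sum)

-- Finite sums of naturals and indicator functions

sum-mono-≤ : ∀ {n} {f g : Fin n → ℕ} → (∀ i → f i ≤ g i) → sum f ≤ sum g
sum-mono-≤ {zero}  f≤g = z≤n
sum-mono-≤ {suc n} f≤g = +-mono-≤ (f≤g zero) (sum-mono-≤ (f≤g ∘ suc))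

sum-mono-< : ∀ {n} {f g : Fin n → ℕ} → (∀ i → f i ≤ g i) → ∀ j → f j < g j → sum f < sum g
sum-mono-< f≤g zero    fj<gj = +-mono-<-≤ fj<gj (sum-mono-≤ (f≤g ∘ suc))
sum-mono-< f≤g (suc j) fj<gj = +-mono-≤-< (f≤g zero) (sum-mono-< (f≤g ∘ suc) j fj<gj)

sum-const : ∀ n c → sum {n} (λ _ → c) ≡ n * c
sum-const zero    c = refl
sum-const (suc n) c = cong (c +_) (sum-const n c)

⟦_⟧ : Bool → ℕ
⟦ true ⟧  = 1
⟦ false ⟧ = 0

⟦⟧≤1 : ∀ c → ⟦ c ⟧ ≤ 1
⟦⟧≤1 true  = ≤-refl
⟦⟧≤1 false = z≤n

infix 7 _==_

_==_ : ∀ {n} → Fin n → Fin n → Bool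
x == y = does (x ≟ y)

==-refl : ∀ {n} (x : Fin n) → (x == x) ≡ true
==-refl x = dec-true (x ≟ x) refl

==-≢ : ∀ {n} {x y : Fin n} → x ≢ y → (x == y) ≡ false
==-≢ {x = x} {y} x≢y = dec-false (x ≟ y) x≢y

sum-indicator : ∀ {n} (r : Fin n) (f : Fin n → ℕ) → sum (λ i → ⟦ i == r ⟧ * f i) ≡ f r
sum-indicator {suc n} zero    f = begin
  f zero + 0 + sum {n} (λ _ → 0)  ≡⟨ cong₂ _+_ (+-identityʳ (f zero)) (trans (sum-const n 0) (*-zeroʳ n)) ⟩
  f zero + 0                      ≡⟨ +-identityʳ (f zero) ⟩
  f zero                          ∎
  where open ≡-Reasoning
sum-indicator (suc r) f = sum-indicator r (f ∘ suc)

sum-indicator-1 : ∀ {n} (r : Fin n) → sum (λ i → ⟦ i == r ⟧) ≡ 1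
sum-indicator-1 r = trans (sum-cong-≗ (λ i → sym (*-identityʳ ⟦ i == r ⟧))) (sum-indicator r (λ _ → 1))

-- 0-1 matrices

Matrix : ℕ → Set
Matrix n = Fin n → Fin n → Bool

_⊆_ : ∀ {n} → Matrix n → Matrix n → Set
f ⊆ A = ∀ x v → f x v ≡ true → A x v ≡ true

row : ∀ {n} → Matrix n → Fin n → ℕ
row f x = sum (λ v → ⟦ f x v ⟧)

col : ∀ {n} → Matrix n → Fin n → ℕ
col f = row (flip f)

_[_,_]≔_ : ∀ {n} → Matrix n → Fin n → Fin n → Bool → Matrix n
(f [ x , v ]≔ c) r s = if (r == x) ∧ (s == v) then c else f r s

-- An equation between naturals, so that row and column sums follow by summation. Read from `g` to
-- `f` it describes the removal of an entry, so one relation covers both halves of a switch.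
Adds : ∀ {n} → Matrix n → Fin n → Fin n → Matrix n → Set
Adds f x v g = ∀ r s → ⟦ g r s ⟧ ≡ ⟦ f r s ⟧ + ⟦ r == x ⟧ * ⟦ s == v ⟧

adds-true : ∀ {n} (f : Matrix n) {x v} → f x v ≡ false → Adds f x v (f [ x , v ]≔ true)
adds-true f {x} {v} fxv r s with r ≟ x | s ≟ v
... | yes refl | yes refl = sym (cong (λ c → ⟦ c ⟧ + 1) fxv)
... | yes _    | no _     = sym (+-identityʳ ⟦ f r s ⟧)
... | no _     | _        = sym (+-identityʳ ⟦ f r s ⟧)

adds-false : ∀ {n} (f : Matrix n) {x v} → f x v ≡ true → Adds (f [ x , v ]≔ false) x v f
adds-false f {x} {v} fxv r s with r ≟ x | s ≟ v
... | yes refl | yes refl = cong ⟦_⟧ fxv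
... | yes _    | no _     = sym (+-identityʳ ⟦ f r s ⟧)
... | no _     | _        = sym (+-identityʳ ⟦ f r s ⟧)

adds-row : ∀ {n} {f g : Matrix n} {x v} → Adds f x v g → ∀ r → row g r ≡ row f r + ⟦ r == x ⟧
adds-row {f = f} {g} {x} {v} f+ r = begin
  row g r                                                ≡⟨ sum-cong-≗ (f+ r) ⟩
  sum (λ s → ⟦ f r s ⟧ + ⟦ r == x ⟧ * ⟦ s == v ⟧)        ≡⟨ ∑-distrib-+ (λ s → ⟦ f r s ⟧) _ ⟩
  row f r + sum (λ s → ⟦ r == x ⟧ * ⟦ s == v ⟧)          ≡⟨ cong (row f r +_) (*-distribˡ-sum ⟦ r == x ⟧ (λ s → ⟦ s == v ⟧)) ⟨
  row f r + ⟦ r == x ⟧ * sum (λ s → ⟦ s == v ⟧)          ≡⟨ cong (λ z → row f r + ⟦ r == x ⟧ * z) (sum-indicator-1 v) ⟩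
  row f r + ⟦ r == x ⟧ * 1                               ≡⟨ cong (row f r +_) (*-identityʳ ⟦ r == x ⟧) ⟩
  row f r + ⟦ r == x ⟧                                   ∎
  where open ≡-Reasoning

adds-col : ∀ {n} {f g : Matrix n} {x v} → Adds f x v g → ∀ s → col g s ≡ col f s + ⟦ s == v ⟧
adds-col {f = f} {g} {x} {v} f+ = adds-row {f = flip f} {flip g} {v} {x}
  λ s r → trans (f+ r s) (cong (⟦ f r s ⟧ +_) (*-comm ⟦ r == x ⟧ ⟦ s == v ⟧))

set-elsewhere : ∀ {n} (f : Matrix n) {x v} c {r} s → r ≢ x → (f [ x , v ]≔ c) r s ≡ f r s
set-elsewhere f {x} c {r} s r≢x rewrite ==-≢ r≢x = refl

set-true-≥ : ∀ {n} (f : Matrix n) {x v} r s → f r s ≡ true → (f [ x , v ]≔ true) r s ≡ true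
set-true-≥ f {x} {v} r s frs with (r == x) ∧ (s == v)
... | true  = refl
... | false = frs

set-false-≤ : ∀ {n} (f : Matrix n) {x v} r s → f r s ≡ false → (f [ x , v ]≔ false) r s ≡ false
set-false-≤ f {x} {v} r s frs with (r == x) ∧ (s == v)
... | true  = refl
... | false = frs

set-true-⊆ : ∀ {n} {A f : Matrix n} {x v} → A x v ≡ true → f ⊆ A → (f [ x , v ]≔ true) ⊆ A
set-true-⊆ {x = x} {v} Axv f⊆A r s frs with r ≟ x | s ≟ v
... | yes refl | yes refl = Axv
... | yes _    | no _     = f⊆A r s frs
... | no _     | _        = f⊆A r s frs

set-false-⊆ : ∀ {n} {A f : Matrix n} {x v} → f ⊆ A → (f [ x , v ]≔ false) ⊆ A
set-false-⊆ {x = x} {v} f⊆A r s frs with (r == x) ∧ (s == v)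
... | true  = contradiction frs λ ()
... | false = f⊆A r s frs

set-same-col : ∀ {n} (f : Matrix n) {x v y} c → f x v ≡ false → f y v ≡ true → (f [ x , v ]≔ c) y v ≡ true
set-same-col f {x} {v} {y} c fxv fyv = trans (set-elsewhere f c v y≢x) fyv
  where
  y≢x : y ≢ x
  y≢x refl = contradiction (trans (sym fxv) fyv) λ ()

-- Alternating walks

module _ {n : ℕ} (A : Matrix n) (u : Fin n) where

  -- Walk f x k is a walk in the bipartite graph of rows and columns, from row u
  -- to row x, that enters k columns through entries of A outside f and leaves
  -- them through entries of f.
  data Walk (f : Matrix n) : Fin n → ℕ → Set where
    start : Walk f u 0
    step  : ∀ {x v y k} → Walk f x k → A x v ≡ true → f x v ≡ false → f y v ≡ true →
            Walk f y (suc k)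

  -- Passing from `f` to `g` may destroy ones only in rows of `P` and zeros only in rows of `Q`. A
  -- step of the walk can therefore break only if it arrives at a row of `P` or departs from a row
  -- of `Q`; in that case the part of the walk up to such a row, still a walk for `f`, is returned.
  -- A row of departure is never the end of the walk, hence the strict bound for `Q`.
  transport : ∀ {f g : Matrix n} {P Q : Fin n → Set} → Decidable P → Decidable Q →
    (∀ r s → ¬ P r → f r s ≡ true → g r s ≡ true) →
    (∀ r s → ¬ Q r → f r s ≡ false → g r s ≡ false) →
    ∀ {z k} → Walk f z k →
    Walk g z k ⊎
    (∃[ x ] ∃[ j ] Q x × j < k × Walk f x j) ⊎
    (∃[ y ] ∃[ j ] P y × j ≤ k × Walk f y j)
  transport P? Q? keep₁ keep₀ start = inj₁ start
  transport P? Q? keep₁ keep₀ (step {x} {v} {y} {k} w Axv fxv fyv)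
    with P? y | Q? x | transport P? Q? keep₁ keep₀ w
  ... | yes Py | _      | _ = inj₂ (inj₂ (y , suc k , Py , ≤-refl , step w Axv fxv fyv))
  ... | no _   | yes Qx | _ = inj₂ (inj₁ (x , k , Qx , ≤-refl , w))
  ... | no ¬Py | no ¬Qx | inj₁ w′ = inj₁ (step w′ Axv (keep₀ x v ¬Qx fxv) (keep₁ y v ¬Py fyv))
  ... | no _   | no _   | inj₂ (inj₁ (z , j , Qz , j<k , w′)) = inj₂ (inj₁ (z , j , Qz , m<n⇒m<1+n j<k , w′))
  ... | no _   | no _   | inj₂ (inj₂ (z , j , Pz , j≤k , w′)) = inj₂ (inj₂ (z , j , Pz , m≤n⇒m≤1+n j≤k , w′))

  -- One unit of row sum moves from row `w` to row `u`. The additive form avoids truncated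
  -- subtraction and includes the case `w = u`.
  Shifted : Matrix n → Fin n → Set
  Shifted f w = ∃[ g ] g ⊆ A × (∀ r → row g r + ⟦ r == w ⟧ ≡ row f r + ⟦ r == u ⟧) ×
                       (∀ s → col g s ≡ col f s)

  -- The last column of the walk is switched first; if this breaks the rest of the
  -- walk, then the walk visits one of the two switched rows earlier and can be cut.
  shift : ∀ N {k f w} → k ≤ N → f ⊆ A → Walk f w k → Shifted f w
  shift N _ f⊆A start = _ , f⊆A , (λ _ → refl) , (λ _ → refl)
  shift (suc N) {suc k} {f} (s≤s k≤N) f⊆A (step {x} {v} {y} w Axv fxv fyv)
    -- The switch destroys a one only in row `y` and a zero only in row `x`. If `x` is met earlier,
    -- column `v` is entered from there; if `y` is met earlier, the walk stops there. Both walks are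
    -- short enough for the bound `N`.
    with transport {g = (f [ x , v ]≔ true) [ y , v ]≔ false} (_≟ y) (_≟ x)
           (λ r s r≢y frs → trans (set-elsewhere (f [ x , v ]≔ true) false s r≢y) (set-true-≥ f r s frs))
           (λ r s r≢x frs → set-false-≤ (f [ x , v ]≔ true) r s (trans (set-elsewhere f true s r≢x) frs)) w
  ... | inj₂ (inj₁ (_ , j , refl , j<k , w′)) = shift N (≤-trans j<k k≤N) f⊆A (step w′ Axv fxv fyv)
  ... | inj₂ (inj₂ (_ , j , refl , j≤k , w′)) = shift N (≤-trans j≤k k≤N) f⊆A w′
  ... | inj₁ w′ = combine (shift N k≤N (set-false-⊆ (set-true-⊆ Axv f⊆A)) w′)
    where
    f₁ f₂ : Matrix n
    f₁ = f [ x , v ]≔ true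
    f₂ = f₁ [ y , v ]≔ false
    f→f₁ : Adds f x v f₁
    f→f₁ = adds-true f fxv
    f₂→f₁ : Adds f₂ y v f₁
    f₂→f₁ = adds-false f₁ (set-same-col f true fxv fyv)
    combine : Shifted f₂ x → Shifted f y
    combine (g , g⊆A , rows , cols) = g , g⊆A , rows′ , cols′
      where
      open ≡-Reasoning
      rows′ : ∀ r → row g r + ⟦ r == y ⟧ ≡ row f r + ⟦ r == u ⟧
      -- Row `x` gains an entry in the switch and gives one up in the recursive shift, so its
      -- indicator cancels.
      rows′ r = +-cancelʳ-≡ ⟦ r == x ⟧ _ _ (begin
        row g r + ⟦ r == y ⟧ + ⟦ r == x ⟧   ≡⟨ swap-last (row g r) _ _ ⟩
        row g r + ⟦ r == x ⟧ + ⟦ r == y ⟧   ≡⟨ cong (_+ ⟦ r == y ⟧) (rows r) ⟩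
        row f₂ r + ⟦ r == u ⟧ + ⟦ r == y ⟧  ≡⟨ swap-last (row f₂ r) _ _ ⟩
        row f₂ r + ⟦ r == y ⟧ + ⟦ r == u ⟧  ≡⟨ cong (_+ ⟦ r == u ⟧) (adds-row f₂→f₁ r) ⟨
        row f₁ r + ⟦ r == u ⟧               ≡⟨ cong (_+ ⟦ r == u ⟧) (adds-row f→f₁ r) ⟩
        row f r + ⟦ r == x ⟧ + ⟦ r == u ⟧   ≡⟨ swap-last (row f r) _ _ ⟩
        row f r + ⟦ r == u ⟧ + ⟦ r == x ⟧   ∎)
        where
        swap-last : ∀ i j k → i + j + k ≡ i + k + j
        swap-last i j k = trans (+-assoc i j k) (trans (cong (i +_) (+-comm j k)) (sym (+-assoc i k j)))
      cols′ : ∀ s → col g s ≡ col f s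
      cols′ s = trans (cols s) (+-cancelʳ-≡ ⟦ s == v ⟧ _ _
        (trans (sym (adds-col f₂→f₁ s)) (adds-col f→f₁ s)))

  Augmented : Matrix n → Fin n → Set
  Augmented f v = ∃[ g ] g ⊆ A × (∀ r → row g r ≡ row f r + ⟦ r == u ⟧) ×
                         (∀ s → col g s ≡ col f s + ⟦ s == v ⟧)

  -- The free entry in row `w` is added first, and the surplus of that row is then shifted to `u`.
  -- Adding an entry destroys no ones, so `P` is empty; it can break only a step departing from `w`,
  -- and then the walk is cut at that earlier visit.
  augment : ∀ N {k f w v} → k < N → f ⊆ A → Walk f w k → A w v ≡ true → f w v ≡ false → Augmented f v
  augment (suc N) {k} {f} {w} {v} (s≤s k≤N) f⊆A walk Awv fwv
    with transport {g = f [ w , v ]≔ true} {P = λ _ → ⊥} (λ _ → no λ ()) (_≟ w)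
           (λ r s _ → set-true-≥ f r s)
           (λ r s r≢w frs → trans (set-elsewhere f true s r≢w) frs) walk
  ... | inj₂ (inj₁ (_ , j , refl , j<k , walk′)) = augment N (≤-trans j<k k≤N) f⊆A walk′ Awv fwv
  ... | inj₁ walk′ with shift k ≤-refl (set-true-⊆ Awv f⊆A) walk′
  ...   | g , g⊆A , rows , cols = g , g⊆A , rows′ , λ s → trans (cols s) (adds-col f+ s)
    where
    f+ : Adds f w v (f [ w , v ]≔ true)
    f+ = adds-true f fwv
    rows′ : ∀ r → row g r ≡ row f r + ⟦ r == u ⟧
    rows′ r = +-cancelʳ-≡ ⟦ r == w ⟧ _ _ (begin
      row g r + ⟦ r == w ⟧                        ≡⟨ rows r ⟩
      row (f [ w , v ]≔ true) r + ⟦ r == u ⟧      ≡⟨ cong (_+ ⟦ r == u ⟧) (adds-row f+ r) ⟩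
      row f r + ⟦ r == w ⟧ + ⟦ r == u ⟧           ≡⟨ +-assoc (row f r) _ _ ⟩
      row f r + (⟦ r == w ⟧ + ⟦ r == u ⟧)         ≡⟨ cong (row f r +_) (+-comm ⟦ r == w ⟧ _) ⟩
      row f r + (⟦ r == u ⟧ + ⟦ r == w ⟧)         ≡⟨ +-assoc (row f r) _ _ ⟨
      row f r + ⟦ r == u ⟧ + ⟦ r == w ⟧           ∎)
      where open ≡-Reasoning

  record ReachableSet (f : Matrix n) : Set where
    field
      R      : Fin n → Bool
      root   : R u ≡ true
      walks  : ∀ x → R x ≡ true → ∃[ k ] Walk f x k
      closed : ∀ x v y → R x ≡ true → A x v ≡ true → f x v ≡ false → f y v ≡ true → R y ≡ true

  -- A row that breaks closedness is one alternating step away from a reached row, so it is reached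
  -- as well and can be added. `N` bounds the number of unreached rows, which drops with each
  -- addition.
  reachable-from : ∀ f N (R : Fin n → Bool) → sum (λ x → ⟦ not (R x) ⟧) ≤ N → R u ≡ true →
                   (∀ x → R x ≡ true → ∃[ k ] Walk f x k) → ReachableSet f
  reachable-from f N R size root walks
    with any? (λ x → any? λ v → any? λ y →
           (R x Bool.≟ true) ×-dec (A x v Bool.≟ true) ×-dec (f x v Bool.≟ false) ×-dec
           (f y v Bool.≟ true) ×-dec (R y Bool.≟ false))
  ... | no none = record { R = R ; root = root ; walks = walks ; closed = closed }
    where
    closed : ∀ x v y → R x ≡ true → A x v ≡ true → f x v ≡ false → f y v ≡ true → R y ≡ true
    closed x v y Rx Axv fxv fyv with R y in Ry
    ... | true  = refl
    ... | false = contradiction (x , v , y , Rx , Axv , fxv , fyv , Ry) none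
  ... | yes (x , v , y , Rx , Axv , fxv , fyv , Ry) = extend N size
    where
    R′ : Fin n → Bool
    R′ z = if z == y then true else R z
    walks′ : ∀ z → R′ z ≡ true → ∃[ k ] Walk f z k
    walks′ z R′z with z ≟ y
    ... | yes refl = let k , w = walks x Rx in suc k , step w Axv fxv fyv
    ... | no _     = walks z R′z
    root′ : R′ u ≡ true
    root′ with u == y
    ... | true  = refl
    ... | false = root
    smaller : sum (λ z → ⟦ not (R′ z) ⟧) < sum (λ z → ⟦ not (R z) ⟧)
    smaller = sum-mono-< ≤R y y<
      where
      ≤R : ∀ z → ⟦ not (R′ z) ⟧ ≤ ⟦ not (R z) ⟧
      ≤R z with z == y
      ... | true  = z≤n
      ... | false = ≤-refl
      y< : ⟦ not (R′ y) ⟧ < ⟦ not (R y) ⟧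
      y< rewrite ==-refl y | Ry = s≤s z≤n
    extend : ∀ N → sum (λ z → ⟦ not (R z) ⟧) ≤ N → ReachableSet f
    extend zero    size = contradiction (≤-trans smaller size) λ ()
    extend (suc N) size = reachable-from f N R′ (≤-pred (≤-trans smaller size)) root′ walks′

  reachable : ∀ f → ReachableSet f
  reachable f = reachable-from f _ (_== u) ≤-refl (==-refl u) walks
    where
    walks : ∀ x → (x == u) ≡ true → ∃[ k ] Walk f x k
    walks x x==u with x ≟ u
    ... | yes refl = 0 , start

-- Hall's condition for the bipartite double cover

-- Counts the entries of `A` in rows of `R` and columns outside `C`. The test on `C` stands first so
-- that the summand reduces to zero as soon as `C v` is known to be true.
arcs : ∀ {n} → Matrix n → (Fin n → Bool) → (Fin n → Bool) → ℕ
arcs A R C = sum (λ x → sum (λ v → ⟦ not (C v) ∧ R x ∧ A x v ⟧))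

card : ∀ {n} → (Fin n → Bool) → ℕ
card R = sum (λ x → ⟦ R x ⟧)

card-complement : ∀ {n} (R : Fin n → Bool) → card (not ∘ R) + card R ≡ n
card-complement {n} R = begin
  card (not ∘ R) + card R              ≡⟨ ∑-distrib-+ (λ v → ⟦ not (R v) ⟧) _ ⟨
  sum (λ v → ⟦ not (R v) ⟧ + ⟦ R v ⟧)  ≡⟨ sum-cong-≗ (λ v → one (R v)) ⟩
  sum {n} (λ _ → 1)                    ≡⟨ trans (sum-const n 1) (*-identityʳ n) ⟩
  n                                    ∎
  where
  open ≡-Reasoning
  one : ∀ c → ⟦ not c ⟧ + ⟦ c ⟧ ≡ 1
  one true  = refl
  one false = refl

-- The cut condition of a flow: rows of `R` demand `a` units each, columns of `C` absorb at most `b`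
-- each, and everything else uses a single arc into a column outside `C`.
Hall : ∀ {n} → Matrix n → ℕ → ℕ → Set
Hall A a b = ∀ R C → a * card R ≤ b * card C + arcs A R C

-- Lowering the deficit of a bounded matrix

module _ {n : ℕ} (A : Matrix n) (a b : ℕ) where

  deficit : Matrix n → ℕ
  deficit f = sum (λ x → a ∸ row f x) + sum (λ v → a ∸ col f v)

  record Bounded (f : Matrix n) : Set where
    field
      within : f ⊆ A
      row≤b  : ∀ x → row f x ≤ b
      col≤b  : ∀ v → col f v ≤ b

  open Bounded

  Improved : Matrix n → Set
  Improved f = ∃[ g ] Bounded g × deficit g < deficit f

  module _ (a≤b : a ≤ b) {f : Matrix n} (F : Bounded f) {u : Fin n} (u<a : row f u < a) where

    private
      -- The term of row `u` drops strictly and no other term grows. A row may lose entries as long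
      -- as it keeps `a` of them, because its truncated difference is then zero.
      improved : ∀ {g} → Bounded g → (∀ r → a ≤ row g r ⊎ row f r ≤ row g r) →
                 row g u ≡ suc (row f u) → (∀ s → col f s ≤ col g s) → Improved f
      improved {g} G rows u+1 cols = g , G , +-mono-<-≤
        (sum-mono-< rows≤ u (∸-monoʳ-< (≤-reflexive (sym u+1)) (subst (_≤ a) (sym u+1) u<a)))
        (sum-mono-≤ λ s → ∸-monoʳ-≤ a (cols s))
        where
        rows≤ : ∀ r → a ∸ row g r ≤ a ∸ row f r
        rows≤ r with rows r
        ... | inj₁ a≤ = subst (_≤ a ∸ row f r) (sym (m≤n⇒m∸n≡0 a≤)) z≤n
        ... | inj₂ ≤g = ∸-monoʳ-≤ a ≤g

      raised≤b : ∀ r → row f r + ⟦ r == u ⟧ ≤ b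
      raised≤b r with r ≟ u
      ... | yes refl = ≤-trans (subst (_≤ a) (sym (+-comm (row f u) 1)) u<a) a≤b
      ... | no _     = subst (_≤ b) (sym (+-identityʳ (row f r))) (row≤b F r)

      raised-u : row f u + ⟦ u == u ⟧ ≡ suc (row f u)
      raised-u rewrite ==-refl u = +-comm (row f u) 1

    -- Row `w` has an entry to spare: after giving one up it still has at least `a`, while row `u`,
    -- being below `a`, stays within `b`.
    shift-improves : ∀ {w} → a < row f w → Shifted A u f w → Improved f
    shift-improves {w} a<w (g , g⊆A , rows , cols) = improved
      record { within = g⊆A
             ; row≤b = λ r → ≤-trans (subst (row g r ≤_) (rows r) (m≤m+n (row g r) _)) (raised≤b r)
             ; col≤b = λ s → subst (_≤ b) (sym (cols s)) (col≤b F s) }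
      rows′
      (trans (trans (sym (+-identityʳ (row g u))) (trans (cong (λ c → row g u + ⟦ c ⟧) (sym (==-≢ u≢w))) (rows u))) raised-u)
      (λ s → ≤-reflexive (sym (cols s)))
      where
      u≢w : u ≢ w
      u≢w refl = <-asym a<w u<a
      rows′ : ∀ r → a ≤ row g r ⊎ row f r ≤ row g r
      rows′ r with r ≟ w | rows r
      ... | yes refl | eq = inj₁ (≤-pred (begin
        suc a                  ≤⟨ a<w ⟩
        row f r                ≤⟨ m≤m+n (row f r) _ ⟩
        row f r + ⟦ r == u ⟧   ≡⟨ eq ⟨
        row g r + 1            ≡⟨ +-comm (row g r) 1 ⟩
        suc (row g r)          ∎))
        where open ≤-Reasoning
      ... | no _     | eq = inj₂ (begin
        row f r                ≤⟨ m≤m+n (row f r) _ ⟩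
        row f r + ⟦ r == u ⟧   ≡⟨ eq ⟨
        row g r + 0            ≡⟨ +-identityʳ (row g r) ⟩
        row g r                ∎)
        where open ≤-Reasoning

    augment-improves : ∀ {v} → col f v < b → Augmented A u f v → Improved f
    augment-improves {v} v<b (g , g⊆A , rows , cols) = improved
      record { within = g⊆A
             ; row≤b = λ r → subst (_≤ b) (sym (rows r)) (raised≤b r)
             ; col≤b = λ s → subst (_≤ b) (sym (cols s)) (raised-col s) }
      (λ r → inj₂ (subst (row f r ≤_) (sym (rows r)) (m≤m+n (row f r) _)))
      (trans (rows u) raised-u)
      (λ s → subst (col f s ≤_) (sym (cols s)) (m≤m+n (col f s) _))
      where
      raised-col : ∀ s → col f s + ⟦ s == v ⟧ ≤ b
      raised-col s with s ≟ v
      ... | yes refl = subst (_≤ b) (sym (+-comm (col f s) 1)) v<b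
      ... | no _     = subst (_≤ b) (sym (+-identityʳ (col f s))) (col≤b F s)

    open ReachableSet

    -- If no improvement is in reach, then the reachable rows R and the columns C
    -- joined to them outside f violate Hall's condition: f saturates every column
    -- of C from rows of R and contains every arc from R to the other columns.
    blocked : (𝓡 : ReachableSet A u f) →
              (∀ w → R 𝓡 w ≡ true → row f w ≤ a) →
              (∀ w v → R 𝓡 w ≡ true → A w v ≡ true → f w v ≡ false → b ≤ col f v) →
              ¬ Hall A a b
    blocked 𝓡 rows≤a cols≥b hall = <⇒≱ violation (hall (R 𝓡) C)
      where
      leaves? : ∀ v → Dec (∃[ x ] R 𝓡 x ≡ true × A x v ≡ true × f x v ≡ false)
      leaves? v = any? λ x → (R 𝓡 x Bool.≟ true) ×-dec (A x v Bool.≟ true) ×-dec (f x v Bool.≟ false)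
      C : Fin n → Bool
      C v = does (leaves? v)
      column : ∀ v → b * ⟦ C v ⟧ + sum (λ x → ⟦ not (C v) ∧ R 𝓡 x ∧ A x v ⟧) ≤ sum (λ x → ⟦ R 𝓡 x ∧ f x v ⟧)
      column v with leaves? v
      ... | yes (x , Rx , Axv , fxv) = begin
        b * 1 + sum {n} (λ _ → 0)      ≡⟨ cong₂ _+_ (*-identityʳ b) (trans (sum-const n 0) (*-zeroʳ n)) ⟩
        b + 0                          ≡⟨ +-identityʳ b ⟩
        b                              ≤⟨ cols≥b x v Rx Axv fxv ⟩
        col f v                        ≤⟨ sum-mono-≤ into-R ⟩
        sum (λ y → ⟦ R 𝓡 y ∧ f y v ⟧)  ∎
        where
        open ≤-Reasoning
        into-R : ∀ y → ⟦ f y v ⟧ ≤ ⟦ R 𝓡 y ∧ f y v ⟧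
        into-R y with f y v in fyv
        ... | false = z≤n
        ... | true rewrite closed 𝓡 x v y Rx Axv fxv fyv = ≤-refl
      ... | no none = begin
        b * 0 + sum (λ x → ⟦ R 𝓡 x ∧ A x v ⟧)  ≡⟨ cong (_+ sum (λ x → ⟦ R 𝓡 x ∧ A x v ⟧)) (*-zeroʳ b) ⟩
        sum (λ x → ⟦ R 𝓡 x ∧ A x v ⟧)          ≤⟨ sum-mono-≤ A≤f ⟩
        sum (λ x → ⟦ R 𝓡 x ∧ f x v ⟧)          ∎
        where
        open ≤-Reasoning
        A≤f : ∀ x → ⟦ R 𝓡 x ∧ A x v ⟧ ≤ ⟦ R 𝓡 x ∧ f x v ⟧
        A≤f x with R 𝓡 x in Rx | A x v in Axv | f x v in fxv
        ... | false | _     | _     = z≤n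
        ... | true  | false | _     = z≤n
        ... | true  | true  | true  = ≤-refl
        ... | true  | true  | false = contradiction (x , Rx , Axv , fxv) none
      violation : b * card C + arcs A (R 𝓡) C < a * card (R 𝓡)
      violation = begin-strict
        b * card C + arcs A (R 𝓡) C
          ≡⟨ cong₂ _+_ (*-distribˡ-sum b (λ v → ⟦ C v ⟧)) (∑-comm (λ x v → ⟦ not (C v) ∧ R 𝓡 x ∧ A x v ⟧)) ⟩
        sum (λ v → b * ⟦ C v ⟧) + sum (λ v → sum (λ x → ⟦ not (C v) ∧ R 𝓡 x ∧ A x v ⟧))
          ≡⟨ ∑-distrib-+ (λ v → b * ⟦ C v ⟧) _ ⟨
        sum (λ v → b * ⟦ C v ⟧ + sum (λ x → ⟦ not (C v) ∧ R 𝓡 x ∧ A x v ⟧))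
          ≤⟨ sum-mono-≤ column ⟩
        sum (λ v → sum (λ x → ⟦ R 𝓡 x ∧ f x v ⟧))
          ≡⟨ ∑-comm (λ x v → ⟦ R 𝓡 x ∧ f x v ⟧) ⟨
        sum (λ x → sum (λ v → ⟦ R 𝓡 x ∧ f x v ⟧))
          -- Strictness comes from row `u`, which is reachable and has sum below `a`.
          <⟨ sum-mono-< (λ x → row≤ x) u (subst (λ c → sum (λ v → ⟦ c ∧ f u v ⟧) < a * ⟦ c ⟧) (sym (root 𝓡)) (subst (row f u <_) (sym (*-identityʳ a)) u<a)) ⟩
        sum (λ x → a * ⟦ R 𝓡 x ⟧)
          ≡⟨ *-distribˡ-sum a (λ x → ⟦ R 𝓡 x ⟧) ⟨
        a * card (R 𝓡)
          ∎
        where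
        open ≤-Reasoning
        row≤ : ∀ x → sum (λ v → ⟦ R 𝓡 x ∧ f x v ⟧) ≤ a * ⟦ R 𝓡 x ⟧
        row≤ x with R 𝓡 x in Rx
        ... | true  = subst (row f x ≤_) (sym (*-identityʳ a)) (rows≤a x Rx)
        ... | false = ≤-reflexive (trans (trans (sum-const n 0) (*-zeroʳ n)) (sym (*-zeroʳ a)))

    improve : Hall A a b → Improved f
    improve hall with reachable A u f
    ... | 𝓡 with any? (λ w → (R 𝓡 w Bool.≟ true) ×-dec (a ℕ.<? row f w))
    ...   | yes (w , Rw , a<w) = let _ , walk = walks 𝓡 w Rw in
      shift-improves a<w (shift A u _ ≤-refl (within F) walk)
    ...   | no none₁
      with any? (λ w → any? λ v → (R 𝓡 w Bool.≟ true) ×-dec (A w v Bool.≟ true) ×-dec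
                                  (f w v Bool.≟ false) ×-dec (col f v ℕ.<? b))
    ...     | yes (w , v , Rw , Awv , fwv , v<b) = let _ , walk = walks 𝓡 w Rw in
      augment-improves v<b (augment A u _ ≤-refl (within F) walk Awv fwv)
    ...     | no none₂ = contradiction hall (blocked 𝓡
      (λ w Rw → ≮⇒≥ λ a<w → none₁ (w , Rw , a<w))
      (λ w v Rw Awv fwv → ≮⇒≥ λ v<b → none₂ (w , v , Rw , Awv , fwv , v<b)))

-- From Hall's condition to a factor

record Factor {n} (A : Matrix n) (a b : ℕ) : Set where
  field
    matrix : Matrix n
    within : matrix ⊆ A
    a≤row  : ∀ x → a ≤ row matrix x
    row≤b  : ∀ x → row matrix x ≤ b
    a≤col  : ∀ v → a ≤ col matrix v
    col≤b  : ∀ v → col matrix v ≤ b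

transpose-bounded : ∀ {n} {A : Matrix n} {a b f} → (∀ x v → A x v ≡ A v x) → Bounded A a b f → Bounded A a b (flip f)
transpose-bounded A-sym F = record
  { within = λ x v fvx → trans (A-sym x v) (within v x fvx)
  ; row≤b  = col≤b
  ; col≤b  = row≤b
  }
  where open Bounded F

-- Well-founded descent on the deficit, starting from the zero matrix; when no row or column is
-- short of `a`, the matrix is a factor.
hall⇒factor : ∀ {n} (A : Matrix n) {a b} → (∀ x v → A x v ≡ A v x) → a ≤ b → Hall A a b → Factor A a b
hall⇒factor {n} A {a} {b} A-sym a≤b hall = complete empty (<-wellFounded _)
  where
  empty : Bounded A a b (λ _ _ → false)
  empty = record
    { within = λ _ _ ()
    ; row≤b  = λ _ → subst (_≤ b) (sym (trans (sum-const n 0) (*-zeroʳ n))) z≤n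
    ; col≤b  = λ _ → subst (_≤ b) (sym (trans (sum-const n 0) (*-zeroʳ n))) z≤n
    }
  complete : ∀ {f} → Bounded A a b f → Acc _<_ (deficit A a b f) → Factor A a b
  complete {f} F (acc rec) with any? (λ x → row f x ℕ.<? a) | any? (λ v → col f v ℕ.<? a)
  ... | yes (x , x<a) | _ = let g , G , g<f = improve A a b a≤b F x<a hall in complete G (rec g<f)
  -- A deficient column is a deficient row of the transpose, which lies below the symmetric `A` too
  -- and has the same deficit with its two summands exchanged. The descent simply continues from the
  -- improved transpose.
  ... | no _ | yes (v , v<a) =
    let g , G , g<f = improve A a b a≤b (transpose-bounded A-sym F) v<a hall
    in complete G (rec (subst (deficit A a b g <_) (+-comm (sum (λ s → a ∸ col f s)) _) g<f))
  ... | no rows | no cols = record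
    { matrix = f
    ; within = Bounded.within F
    ; a≤row  = λ x → ≮⇒≥ λ x<a → rows (x , x<a)
    ; row≤b  = Bounded.row≤b F
    ; a≤col  = λ v → ≮⇒≥ λ v<a → cols (v , v<a)
    ; col≤b  = Bounded.col≤b F
    }

-- Arithmetic of a violation in a dense graph

cancel-common : ∀ c {l r L R} → L ≡ c + l → R ≡ c + r → L ≤ R → l ≤ r
cancel-common c refl refl = +-cancelˡ-≤ c _ _

-- Here m = u + t is the order of the graph and t = b + 1 + k; s and t are the
-- sizes of S and T, D counts the arcs from T to the complement of S, and W is
-- the sum of all degrees.
no-dense-violation : ∀ a b s k u D W → a ≤ b → s ≤ u →
  4 * a + 4 * b + 7 ≤ u + (suc b + k) →
  b * s + D + 1 ≤ a * (suc b + k) →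
  W + u ≤ u * u + 2 * (D + s * (suc b + k)) →
  (u + k) * (u + k) + 2 * (a * (b + 2)) ≤ W + (u + k) →
  ⊥
no-dense-violation a b s k u D W a≤b s≤u large violated edges≤ edges≥ = <⇒≱ too-large large
  where
  -- With `t = b + 1 + k`, the violation gives `b s < a t`, and `a ≤ b` gives `a t ≤ b (a + 1 + k)`;
  -- then `b` is cancelled.
  s≤a+k : s ≤ a + k
  s≤a+k = ≤-pred (*-cancelˡ-< b s (suc (a + k)) (begin-strict
    b * s                     <⟨ ≤-reflexive (+-comm 1 (b * s)) ⟩
    b * s + 1                 ≤⟨ +-monoˡ-≤ 1 (m≤m+n (b * s) D) ⟩
    b * s + D + 1             ≤⟨ violated ⟩
    a * (suc b + k)           ≡⟨ expand a b k ⟩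
    b * a + a * (1 + k)       ≤⟨ +-monoʳ-≤ (b * a) (*-monoˡ-≤ (1 + k) a≤b) ⟩
    b * a + b * (1 + k)       ≡⟨ collect a b k ⟩
    b * suc (a + k)           ∎))
    where
    open ≤-Reasoning
    expand : ∀ a b k → a * (suc b + k) ≡ b * a + a * (1 + k)
    expand = solve-∀
    collect : ∀ a b k → b * a + b * (1 + k) ≡ b * suc (a + k)
    collect = solve-∀

  -- The lower and the upper bound for `W` are added to twice the violation, so that `W`, `D`, `b s`
  -- and `a b` all disappear. `cancel-common` strips the summands shared by both sides.
  key : 2 * (u * k) + k * k + 2 * a + 2 ≤ 2 * (a * k) + 2 * ((k + 1) * s) + k
  key = cancel-common (u * u + W + u + 2 * (a * b) + 2 * a + 2 * (b * s) + 2 * D)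
    (left a b s k u D W) (right a b s k u D W)
    (+-mono-≤ (+-mono-≤ edges≥ edges≤) (*-monoʳ-≤ 2 violated))
    where
    left : ∀ a b s k u D W →
      (u + k) * (u + k) + 2 * (a * (b + 2)) + (W + u) + 2 * (b * s + D + 1) ≡
      (u * u + W + u + 2 * (a * b) + 2 * a + 2 * (b * s) + 2 * D) + (2 * (u * k) + k * k + 2 * a + 2)
    left = solve-∀
    right : ∀ a b s k u D W →
      W + (u + k) + (u * u + 2 * (D + s * (suc b + k))) + 2 * (a * (suc b + k)) ≡
      (u * u + W + u + 2 * (a * b) + 2 * a + 2 * (b * s) + 2 * D) + (2 * (a * k) + 2 * ((k + 1) * s) + k)
    right = solve-∀

  -- In `key` the term `2 (k + 1) s` is split: `2 k s` is bounded through `s ≤ u`, which removes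
  -- `u`, and `2 s` through `s ≤ a + k`. The constant 2 keeps the inequality strict, so `k` can be
  -- cancelled.
  k<2a+3 : k < 2 * a + 3
  k<2a+3 = *-cancelˡ-< k k (2 * a + 3) (≤-trans (m≤n+m (suc (k * k)) 1)
    (cancel-common (2 * (u * k) + 2 * a + 2 * (k * s) + 2 * s)
      (left a s k u) (right a s k u)
      (+-mono-≤ key (+-mono-≤ (*-monoʳ-≤ (2 * k) s≤u) (*-monoʳ-≤ 2 s≤a+k)))))
    where
    left : ∀ a s k u → 2 * (u * k) + k * k + 2 * a + 2 + (2 * k * s + 2 * s) ≡
      (2 * (u * k) + 2 * a + 2 * (k * s) + 2 * s) + (1 + suc (k * k))
    left = solve-∀
    right : ∀ a s k u → 2 * (a * k) + 2 * ((k + 1) * s) + k + (2 * k * u + 2 * (a + k)) ≡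
      (2 * (u * k) + 2 * a + 2 * (k * s) + 2 * s) + k * (2 * a + 3)
    right = solve-∀

  -- Here all of `2 (k + 1) s` is bounded through `s ≤ a + k`, which leaves a bound on `u`.
  2u<4a+k+3 : 2 * u < 4 * a + k + 3
  2u<4a+k+3 = *-cancelˡ-< k (2 * u) (4 * a + k + 3) (≤-trans (m≤n+m (suc (k * (2 * u))) 1)
    (cancel-common (k * k + 2 * a + 2 * ((k + 1) * s))
      (left a s k u) (right a s k)
      (+-mono-≤ key (*-monoʳ-≤ (2 * (k + 1)) s≤a+k))))
    where
    left : ∀ a s k u → 2 * (u * k) + k * k + 2 * a + 2 + 2 * (k + 1) * s ≡
      (k * k + 2 * a + 2 * ((k + 1) * s)) + (1 + suc (k * (2 * u)))
    left = solve-∀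
    right : ∀ a s k → 2 * (a * k) + 2 * ((k + 1) * s) + k + 2 * (k + 1) * (a + k) ≡
      (k * k + 2 * a + 2 * ((k + 1) * s)) + k * (4 * a + k + 3)
    right = solve-∀

  -- Twice the order is below `4 a + 3 k + 2 b + 5`; with `k ≤ 2 a + 2` and `4 a ≤ 4 b` this is at
  -- most `6 a + 6 b + 11`.
  too-large : u + (suc b + k) < 4 * a + 4 * b + 7
  too-large = *-cancelˡ-< 2 _ _ (begin-strict
    2 * (u + (suc b + k))                           ≡⟨ regroup b k u ⟩
    2 * u + (2 * k + 2 * b + 2)                     <⟨ +-monoˡ-< _ 2u<4a+k+3 ⟩
    4 * a + k + 3 + (2 * k + 2 * b + 2)             ≡⟨ regroup′ a b k ⟩
    3 * k + (4 * a + 2 * b + 5)                     ≤⟨ +-monoˡ-≤ _ (*-monoʳ-≤ 3 k≤) ⟩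
    3 * (2 * a + 2) + (4 * a + 2 * b + 5)           ≤⟨ +-monoʳ-≤ (3 * (2 * a + 2)) (+-monoˡ-≤ 5 (+-monoˡ-≤ (2 * b) (*-monoʳ-≤ 4 a≤b))) ⟩
    3 * (2 * a + 2) + (4 * b + 2 * b + 5)           ≤⟨ m≤m+n _ (2 * a + 2 * b + 3) ⟩
    3 * (2 * a + 2) + (4 * b + 2 * b + 5) + (2 * a + 2 * b + 3)  ≡⟨ regroup″ a b ⟩
    2 * (4 * a + 4 * b + 7)                         ∎)
    where
    open ≤-Reasoning
    k≤ : k ≤ 2 * a + 2
    k≤ = ≤-pred (subst (suc k ≤_) (+-suc (2 * a) 2) k<2a+3)
    regroup : ∀ b k u → 2 * (u + (suc b + k)) ≡ 2 * u + (2 * k + 2 * b + 2)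
    regroup = solve-∀
    regroup′ : ∀ a b k → 4 * a + k + 3 + (2 * k + 2 * b + 2) ≡ 3 * k + (4 * a + 2 * b + 5)
    regroup′ = solve-∀
    regroup″ : ∀ a b → 3 * (2 * a + 2) + (4 * b + 2 * b + 5) + (2 * a + 2 * b + 3) ≡ 2 * (4 * a + 4 * b + 7)
    regroup″ = solve-∀

-- Hall's condition from the number of edges

total : ∀ {n} → Matrix n → ℕ
total A = sum (row A)

sum₂-cong : ∀ {m n} {f g : Fin m → Fin n → ℕ} → (∀ i j → f i j ≡ g i j) →
            sum (λ i → sum (f i)) ≡ sum (λ i → sum (g i))
sum₂-cong f≡g = sum-cong-≗ λ i → sum-cong-≗ (f≡g i)

sum₂-mono : ∀ {m n} {f g : Fin m → Fin n → ℕ} → (∀ i j → f i j ≤ g i j) →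
            sum (λ i → sum (f i)) ≤ sum (λ i → sum (g i))
sum₂-mono f≤g = sum-mono-≤ λ i → sum-mono-≤ (f≤g i)

sum₂-distrib-+ : ∀ {m n} (f g : Fin m → Fin n → ℕ) →
  sum (λ i → sum (λ j → f i j + g i j)) ≡ sum (λ i → sum (f i)) + sum (λ i → sum (g i))
sum₂-distrib-+ f g = trans (sum-cong-≗ λ i → ∑-distrib-+ (f i) (g i)) (∑-distrib-+ (λ i → sum (f i)) _)

sum₂-product : ∀ {m n} (f : Fin m → ℕ) (g : Fin n → ℕ) → sum (λ i → sum (λ j → f i * g j)) ≡ sum f * sum g
sum₂-product f g = begin
  sum (λ i → sum (λ j → f i * g j))  ≡⟨ sum-cong-≗ (λ i → *-distribˡ-sum (f i) g) ⟨
  sum (λ i → f i * sum g)            ≡⟨ *-distribʳ-sum (sum g) f ⟨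
  sum f * sum g                      ∎
  where
  open ≡-Reasoning

module _ {m : ℕ} (A : Matrix m) (A-sym : ∀ x v → A x v ≡ A v x) (A-irrefl : ∀ x → A x x ≡ false)
         {a b : ℕ} (a≤b : a ≤ b) (a≤deg : ∀ x → a ≤ row A x)
         (large : 4 * a + 4 * b + 7 ≤ m)
         -- M = m - b - 1, and M * M - M is twice the binomial coefficient M C 2.
         (dense : ∀ M → m ≡ suc b + M → M * M + 2 * (a * (b + 2)) ≤ total A + M) where

  -- S = C \ R and T = R \ C violate Hall's condition as well.
  module _ (R C : Fin m → Bool) (violated : b * card C + arcs A R C < a * card R) where
    private
      S T X : Fin m → Bool
      S v = C v ∧ not (R v)
      T v = R v ∧ not (C v)
      X v = R v ∧ C v

      s t u p D : ℕ
      s = card S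
      t = card T
      p = card X
      u = card (not ∘ T)
      D = sum (λ x → sum (λ v → ⟦ T x ∧ not (S v) ∧ A x v ⟧))

      R-split : card R ≡ t + p
      R-split = trans (sum-cong-≗ (λ v → split (R v) (C v))) (∑-distrib-+ (λ v → ⟦ T v ⟧) _)
        where
        split : ∀ r c → ⟦ r ⟧ ≡ ⟦ r ∧ not c ⟧ + ⟦ r ∧ c ⟧
        split false _     = refl
        split true  false = refl
        split true  true  = refl

      C-split : card C ≡ s + p
      C-split = trans (sum-cong-≗ (λ v → split (R v) (C v))) (∑-distrib-+ (λ v → ⟦ S v ⟧) _)
        where
        split : ∀ r c → ⟦ c ⟧ ≡ ⟦ c ∧ not r ⟧ + ⟦ r ∧ c ⟧
        split false false = refl
        split false true  = refl
        split true  false = refl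
        split true  true  = refl

      -- An arc counted by `D` goes from `T` either to a vertex outside `C` or to one in `X`.
      -- Reversed by symmetry, the second kind leads from `X` to `T`, thus from `R` to the
      -- complement of `C`. The two kinds start in the disjoint sets `T` and `X`, so no arc is
      -- counted twice.
      D≤arcs : D ≤ arcs A R C
      D≤arcs = begin
        D
          ≡⟨ sum₂-cong (λ x v → split (R x) (C x) (R v) (C v) (A x v)) ⟩
        sum (λ x → sum (λ v → ⟦ T x ∧ not (C v) ∧ A x v ⟧ + ⟦ T x ∧ X v ∧ A x v ⟧))
          ≡⟨ sum₂-distrib-+ (λ x v → ⟦ T x ∧ not (C v) ∧ A x v ⟧) _ ⟩
        outer + sum (λ x → sum (λ v → ⟦ T x ∧ X v ∧ A x v ⟧))
          ≡⟨ cong (outer +_) (∑-comm (λ x v → ⟦ T x ∧ X v ∧ A x v ⟧)) ⟩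
        outer + sum (λ v → sum (λ x → ⟦ T x ∧ X v ∧ A x v ⟧))
          ≡⟨ cong (outer +_) (sum₂-cong (λ v x → cong (λ c → ⟦ T x ∧ X v ∧ c ⟧) (A-sym x v))) ⟩
        outer + sum (λ v → sum (λ x → ⟦ T x ∧ X v ∧ A v x ⟧))
          ≡⟨ sum₂-distrib-+ (λ x v → ⟦ T x ∧ not (C v) ∧ A x v ⟧) _ ⟨
        sum (λ x → sum (λ v → ⟦ T x ∧ not (C v) ∧ A x v ⟧ + ⟦ T v ∧ X x ∧ A x v ⟧))
          ≤⟨ sum₂-mono (λ x v → merge (R x) (C x) (R v) (C v) (A x v)) ⟩
        arcs A R C
          ∎
        where
        open ≤-Reasoning
        outer : ℕ
        outer = sum (λ x → sum (λ v → ⟦ T x ∧ not (C v) ∧ A x v ⟧))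
        split : ∀ r c r′ c′ e → ⟦ (r ∧ not c) ∧ not (c′ ∧ not r′) ∧ e ⟧ ≡
                ⟦ (r ∧ not c) ∧ not c′ ∧ e ⟧ + ⟦ (r ∧ not c) ∧ (r′ ∧ c′) ∧ e ⟧
        split false _    _     _     _ = refl
        split true true  _     _     _ = refl
        split true false false false e = sym (+-identityʳ ⟦ e ⟧)
        split true false false true  _ = refl
        split true false true  false e = sym (+-identityʳ ⟦ e ⟧)
        split true false true  true  _ = refl
        merge : ∀ r c r′ c′ e → ⟦ (r ∧ not c) ∧ not c′ ∧ e ⟧ + ⟦ (r′ ∧ not c′) ∧ (r ∧ c) ∧ e ⟧ ≤
                ⟦ not c′ ∧ r ∧ e ⟧
        merge false _     false _     _ = z≤n
        merge false _     true  false _ = z≤n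
        merge false _     true  true  _ = z≤n
        merge true  false false false e = ≤-reflexive (+-identityʳ ⟦ e ⟧)
        merge true  false true  false e = ≤-reflexive (+-identityʳ ⟦ e ⟧)
        merge true  true  false false _ = z≤n
        merge true  true  true  false _ = ≤-refl
        merge true  false false true  _ = z≤n
        merge true  false true  true  _ = z≤n
        merge true  true  false true  _ = z≤n
        merge true  true  true  true  _ = z≤n

      -- The common part `X` contributes `b p` to the smaller side and `a p` to the larger one, so
      -- `a ≤ b` allows it to be dropped.
      violated′ : b * s + D + 1 ≤ a * t
      violated′ = +-cancelʳ-≤ (a * p) _ _ (begin
        b * s + D + 1 + a * p        ≤⟨ +-monoʳ-≤ _ (*-monoˡ-≤ p a≤b) ⟩
        b * s + D + 1 + b * p        ≡⟨ regroup b s D p ⟩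
        suc (b * (s + p) + D)        ≤⟨ s≤s (+-monoʳ-≤ _ D≤arcs) ⟩
        suc (b * (s + p) + arcs A R C)  ≡⟨ cong (λ c → suc (b * c + arcs A R C)) C-split ⟨
        suc (b * card C + arcs A R C)   ≤⟨ violated ⟩
        a * card R                   ≡⟨ cong (a *_) R-split ⟩
        a * (t + p)                  ≡⟨ *-distribˡ-+ a t p ⟩
        a * t + a * p                ∎)
        where
        open ≤-Reasoning
        regroup : ∀ b s D p → b * s + D + 1 + b * p ≡ suc (b * (s + p) + D)
        regroup = solve-∀

      arcs-from-T : ℕ
      arcs-from-T = sum (λ x → sum (λ v → ⟦ T x ∧ A x v ⟧))

      arcs-from-T≤ : arcs-from-T ≤ D + s * t
      arcs-from-T≤ = begin
        arcs-from-T
          ≤⟨ sum₂-mono (λ x v → split (T x) (S v) (A x v)) ⟩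
        sum (λ x → sum (λ v → ⟦ T x ∧ not (S v) ∧ A x v ⟧ + ⟦ T x ⟧ * ⟦ S v ⟧))
          ≡⟨ sum₂-distrib-+ (λ x v → ⟦ T x ∧ not (S v) ∧ A x v ⟧) _ ⟩
        D + sum (λ x → sum (λ v → ⟦ T x ⟧ * ⟦ S v ⟧))
          ≡⟨ cong (D +_) (trans (sum₂-product (λ x → ⟦ T x ⟧) (λ v → ⟦ S v ⟧)) (*-comm t s)) ⟩
        D + s * t
          ∎
        where
        open ≤-Reasoning
        split : ∀ τ σ e → ⟦ τ ∧ e ⟧ ≤ ⟦ τ ∧ not σ ∧ e ⟧ + ⟦ τ ⟧ * ⟦ σ ⟧
        split false _ _         = z≤n
        split true false e      = m≤m+n ⟦ e ⟧ 0
        split true true  true   = ≤-refl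
        split true true  false  = z≤n

      degrees : a * t ≤ D + s * t
      degrees = begin
        a * t                    ≡⟨ *-distribˡ-sum a (λ x → ⟦ T x ⟧) ⟩
        sum (λ x → a * ⟦ T x ⟧)  ≤⟨ sum-mono-≤ row≥ ⟩
        arcs-from-T              ≤⟨ arcs-from-T≤ ⟩
        D + s * t                ∎
        where
        open ≤-Reasoning
        row≥ : ∀ x → a * ⟦ T x ⟧ ≤ sum (λ v → ⟦ T x ∧ A x v ⟧)
        row≥ x with T x
        ... | true  = subst (_≤ row A x) (sym (*-identityʳ a)) (a≤deg x)
        ... | false = subst (_≤ sum {m} (λ _ → 0)) (sym (*-zeroʳ a)) z≤n

      order : u + t ≡ m
      order = card-complement T

      s≤u : s ≤ u
      s≤u = sum-mono-≤ λ v → disjoint (R v) (C v)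
        where
        disjoint : ∀ r c → ⟦ c ∧ not r ⟧ ≤ ⟦ not (r ∧ not c) ⟧
        disjoint false false = z≤n
        disjoint false true  = ≤-refl
        disjoint true  false = z≤n
        disjoint true  true  = z≤n

      -- An arc lies outside `T` altogether or has an end in `T`. The extra `u` on the left stands
      -- for the diagonal pairs outside `T`, which are among the `u * u` pairs but carry no arc.
      total≤ : total A + u ≤ u * u + 2 * (D + s * t)
      total≤ = begin
        total A + u
          ≡⟨ cong (total A +_) (sum-cong-≗ (λ x → sum-indicator x (λ _ → ⟦ not (T x) ⟧))) ⟨
        total A + sum (λ x → sum (λ v → ⟦ v == x ⟧ * ⟦ not (T x) ⟧))
          ≡⟨ sum₂-distrib-+ (λ x v → ⟦ A x v ⟧) _ ⟨
        sum (λ x → sum (λ v → ⟦ A x v ⟧ + ⟦ v == x ⟧ * ⟦ not (T x) ⟧))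
          ≤⟨ sum₂-mono pointwise ⟩
        sum (λ x → sum (λ v → ⟦ not (T x) ⟧ * ⟦ not (T v) ⟧ + (⟦ T x ∧ A x v ⟧ + ⟦ T v ∧ A x v ⟧)))
          ≡⟨ sum₂-distrib-+ (λ x v → ⟦ not (T x) ⟧ * ⟦ not (T v) ⟧) _ ⟩
        sum (λ x → sum (λ v → ⟦ not (T x) ⟧ * ⟦ not (T v) ⟧)) +
        sum (λ x → sum (λ v → ⟦ T x ∧ A x v ⟧ + ⟦ T v ∧ A x v ⟧))
          ≡⟨ cong₂ _+_ (sum₂-product (λ x → ⟦ not (T x) ⟧) (λ v → ⟦ not (T v) ⟧))
                       (sum₂-distrib-+ (λ x v → ⟦ T x ∧ A x v ⟧) _) ⟩
        u * u + (arcs-from-T + sum (λ x → sum (λ v → ⟦ T v ∧ A x v ⟧)))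
          ≡⟨ cong (λ z → u * u + (arcs-from-T + z)) arcs-into-T ⟩
        u * u + (arcs-from-T + arcs-from-T)
          ≡⟨ cong (λ z → u * u + (arcs-from-T + z)) (+-identityʳ arcs-from-T) ⟨
        u * u + 2 * arcs-from-T
          ≤⟨ +-monoʳ-≤ (u * u) (*-monoʳ-≤ 2 arcs-from-T≤) ⟩
        u * u + 2 * (D + s * t)
          ∎
        where
        open ≤-Reasoning
        arcs-into-T : sum (λ x → sum (λ v → ⟦ T v ∧ A x v ⟧)) ≡ arcs-from-T
        arcs-into-T = trans (∑-comm (λ x v → ⟦ T v ∧ A x v ⟧))
          (sum₂-cong λ v x → cong (λ c → ⟦ T v ∧ c ⟧) (A-sym x v))
        pointwise : ∀ x v → ⟦ A x v ⟧ + ⟦ v == x ⟧ * ⟦ not (T x) ⟧ ≤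
                    ⟦ not (T x) ⟧ * ⟦ not (T v) ⟧ + (⟦ T x ∧ A x v ⟧ + ⟦ T v ∧ A x v ⟧)
        pointwise x v with v ≟ x
        ... | yes refl rewrite A-irrefl x = diagonal (T x)
          where
          diagonal : ∀ c → ⟦ not c ⟧ + 0 ≤ ⟦ not c ⟧ * ⟦ not c ⟧ + (⟦ c ∧ false ⟧ + ⟦ c ∧ false ⟧)
          diagonal true  = z≤n
          diagonal false = ≤-refl
        ... | no _ = general (T x) (T v) (A x v)
          where
          general : ∀ c d e → ⟦ e ⟧ + 0 ≤ ⟦ not c ⟧ * ⟦ not d ⟧ + (⟦ c ∧ e ⟧ + ⟦ d ∧ e ⟧)
          general c     d     false = z≤n
          general true  d     true  = s≤s z≤n
          general false true  true  = s≤s z≤n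
          general false false true  = s≤s z≤n

      b<t : b < t
      b<t = *-cancelˡ-< s b t (≤-trans (≤-reflexive (trans (cong suc (*-comm s b)) (+-comm 1 (b * s))))
        (+-cancelˡ-≤ D _ _ (≤-trans (≤-reflexive (regroup b s D)) (≤-trans violated′ degrees))))
        where
        regroup : ∀ b s D → D + (b * s + 1) ≡ b * s + D + 1
        regroup = solve-∀

    violation-impossible : ⊥
    violation-impossible with m≤n⇒∃[o]m+o≡n b<t
    ... | k , t≡ = no-dense-violation a b s k u D (total A) a≤b s≤u
      (subst (4 * a + 4 * b + 7 ≤_) m≡ large)
      (subst (λ t → b * s + D + 1 ≤ a * t) (sym t≡) violated′)
      (subst (λ t → total A + u ≤ u * u + 2 * (D + s * t)) (sym t≡) total≤)
      (dense (u + k) (trans m≡ (regroup b k u)))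
      where
      m≡ : m ≡ u + (suc b + k)
      m≡ = trans (sym order) (cong (u +_) (sym t≡))
      regroup : ∀ b k u → u + (suc b + k) ≡ suc b + (u + k)
      regroup = solve-∀

  dense⇒hall : Hall A a b
  dense⇒hall R C = ≮⇒≥ (violation-impossible R C)

-- Sums over lists

sumOf : ∀ {X : Set} → (X → ℕ) → List X → ℕ
sumOf g xs = List.sum (map g xs)

sumOf-lookup : ∀ {X : Set} (g : X → ℕ) xs → sum (λ i → g (lookup xs i)) ≡ sumOf g xs
sumOf-lookup g []       = refl
sumOf-lookup g (x ∷ xs) = cong (g x +_) (sumOf-lookup g xs)

sumOf-filter : ∀ {X : Set} {P : Pred X 0ℓ} (P? : Decidable P) (g : X → ℕ) xs →
               sumOf g (filter P? xs) ≡ sumOf (λ x → ⟦ does (P? x) ⟧ * g x) xs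
sumOf-filter P? g []       = refl
sumOf-filter P? g (x ∷ xs) with does (P? x)
... | true  = cong₂ _+_ (sym (+-identityʳ (g x))) (sumOf-filter P? g xs)
... | false = sumOf-filter P? g xs

sumOf-allFin : ∀ {n} (g : Fin n → ℕ) → sumOf g (allFin n) ≡ sum g
sumOf-allFin {n} g = trans (cong List.sum (map-tabulate (λ i → i) g)) (sum-tabulate g)
  where
  sum-tabulate : ∀ {n} (g : Fin n → ℕ) → List.sum (tabulate g) ≡ sum g
  sum-tabulate {zero}  g = refl
  sum-tabulate {suc n} g = cong (g zero +_) (sum-tabulate (g ∘ suc))

sumOf-cartesianProduct : ∀ {X Y : Set} (g : X × Y → ℕ) xs ys →
  sumOf g (cartesianProduct xs ys) ≡ sumOf (λ x → sumOf (λ y → g (x , y)) ys) xs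
sumOf-cartesianProduct g []       ys = refl
sumOf-cartesianProduct g (x ∷ xs) ys = begin
  sumOf g (map (x ,_) ys ++ cartesianProduct xs ys)
    ≡⟨ cong List.sum (map-++ g (map (x ,_) ys) _) ⟩
  List.sum (map g (map (x ,_) ys) ++ map g (cartesianProduct xs ys))
    ≡⟨ sum-++ (map g (map (x ,_) ys)) _ ⟩
  sumOf g (map (x ,_) ys) + sumOf g (cartesianProduct xs ys)
    ≡⟨ cong₂ _+_ (cong List.sum (sym (map-∘ ys))) (sumOf-cartesianProduct g xs ys) ⟩
  sumOf (λ y → g (x , y)) ys + sumOf (λ x → sumOf (λ y → g (x , y)) ys) xs
    ∎
  where open ≡-Reasoning

sumOf-filter-allFin : ∀ {n} {P : Pred (Fin n) 0ℓ} (P? : Decidable P) (g : Fin n → ℕ) →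
                      sumOf g (filter P? (allFin n)) ≡ sum (λ x → ⟦ does (P? x) ⟧ * g x)
sumOf-filter-allFin P? g = trans (sumOf-filter P? g (allFin _)) (sumOf-allFin (λ x → ⟦ does (P? x) ⟧ * g x))

length≡sumOf-1 : ∀ {X : Set} (xs : List X) → length xs ≡ sumOf (λ _ → 1) xs
length≡sumOf-1 []       = refl
length≡sumOf-1 (_ ∷ xs) = cong suc (length≡sumOf-1 xs)

length-filter-allFin : ∀ {n} {P : Pred (Fin n) 0ℓ} (P? : Decidable P) →
                       length (filter P? (allFin n)) ≡ sum (λ x → ⟦ does (P? x) ⟧)
length-filter-allFin P? = trans (length≡sumOf-1 (filter P? (allFin _)))
  (trans (sumOf-filter-allFin P? _) (sum-cong-≗ λ x → *-identityʳ ⟦ does (P? x) ⟧))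

-- Graphs and their adjacency matrices

module _ {n : ℕ} (G : Graph n) where
  open Graph G

  adjacency : Matrix n
  adjacency x y = does (x ∼? y)

  adjacency-sym : ∀ x y → adjacency x y ≡ adjacency y x
  adjacency-sym x y = does-⇔ (mk⇔ ∼-sym ∼-sym) (x ∼? y) (y ∼? x)

  adjacency-irrefl : ∀ x → adjacency x x ≡ false
  adjacency-irrefl x = dec-false (x ∼? x) (∼-irrefl refl)

  private
    up : Matrix n
    up x y = does (x <? y) ∧ adjacency x y

    -- By trichotomy exactly one orientation of an edge is increasing, and that is the one kept in
    -- `edges`.
    up-split : ∀ (g : Fin n → Fin n → ℕ) → (∀ x y → g x y ≡ g y x) →
               ∀ x y → ⟦ up x y ⟧ * g x y + ⟦ up y x ⟧ * g y x ≡ ⟦ adjacency x y ⟧ * g x y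
    up-split g g-sym x y with Fin.<-cmp x y
    ... | tri< x<y _ y≮x rewrite dec-true (x <? y) x<y | dec-false (y <? x) y≮x = +-identityʳ _
    ... | tri> x≮y _ y<x rewrite dec-false (x <? y) x≮y | dec-true (y <? x) y<x | adjacency-sym y x | g-sym y x = refl
    ... | tri≈ x≮x refl _ rewrite dec-false (x <? x) x≮x | adjacency-irrefl x = refl

  sumOf-edges : ∀ (g : Fin n × Fin n → ℕ) → sumOf g (edges G) ≡ sum (λ x → sum (λ y → ⟦ up x y ⟧ * g (x , y)))
  sumOf-edges g = begin
    sumOf g (edges G)
      ≡⟨ sumOf-filter (λ (u , v) → (u Fin.<? v) ×-dec (u ∼? v)) g (cartesianProduct (allFin n) (allFin n)) ⟩
    sumOf g′ (cartesianProduct (allFin n) (allFin n))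
      ≡⟨ sumOf-cartesianProduct g′ (allFin n) (allFin n) ⟩
    sumOf (λ x → sumOf (λ y → g′ (x , y)) (allFin n)) (allFin n)
      ≡⟨ sumOf-allFin (λ x → sumOf (λ y → g′ (x , y)) (allFin n)) ⟩
    sum (λ x → sumOf (λ y → g′ (x , y)) (allFin n))
      ≡⟨ sum-cong-≗ (λ x → sumOf-allFin (λ y → g′ (x , y))) ⟩
    sum (λ x → sum (λ y → g′ (x , y)))
      ∎
    where
    open ≡-Reasoning
    g′ : Fin n × Fin n → ℕ
    g′ (x , y) = ⟦ up x y ⟧ * g (x , y)

  handshake : 2 * e G ≡ total adjacency
  handshake = begin
    2 * e G
      ≡⟨ cong (e G +_) (+-identityʳ (e G)) ⟩
    e G + e G
      ≡⟨ cong₂ _+_ e≡ (trans e≡ (∑-comm (λ x y → ⟦ up x y ⟧ * 1))) ⟩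
    sum (λ x → sum (λ y → ⟦ up x y ⟧ * 1)) + sum (λ x → sum (λ y → ⟦ up y x ⟧ * 1))
      ≡⟨ sum₂-distrib-+ (λ x y → ⟦ up x y ⟧ * 1) _ ⟨
    sum (λ x → sum (λ y → ⟦ up x y ⟧ * 1 + ⟦ up y x ⟧ * 1))
      ≡⟨ sum₂-cong (λ x y → trans (up-split (λ _ _ → 1) (λ _ _ → refl) x y) (*-identityʳ _)) ⟩
    total adjacency
      ∎
    where
    open ≡-Reasoning
    e≡ : e G ≡ sum (λ x → sum (λ y → ⟦ up x y ⟧ * 1))
    e≡ = trans (length≡sumOf-1 (edges G)) (sumOf-edges (λ _ → 1))

  degree≡row : ∀ x → degree G x ≡ row adjacency x
  degree≡row x = length-filter-allFin (x ∼?_)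

  δ≤row : ∀ x → δ G ≤ row adjacency x
  δ≤row x = subst (δ G ≤_) (degree≡row x)
    (All.lookup (min≤xs n (map (degree G) (allFin n))) (∈-map⁺ (degree G) (∈-allFin x)))

  -- An edge at `w` is listed with `w` as its first or as its second end. The two cases are summed
  -- separately, and `up-split` reunites them into one sum over the neighbours of `w`.
  incident-sum : ∀ (g : Fin n → Fin n → ℕ) → (∀ x y → g x y ≡ g y x) → ∀ w →
    sumOf (λ x → uncurry g (lookup (edges G) x)) (filter (incident? G w) (allFin (e G))) ≡
    sum (λ y → ⟦ adjacency w y ⟧ * g w y)
  incident-sum g g-sym w = begin
    sumOf (λ x → uncurry g (lookup (edges G) x)) (filter (incident? G w) (allFin (e G)))
      ≡⟨ sumOf-filter-allFin (incident? G w) _ ⟩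
    sum (λ i → at-w (lookup (edges G) i))
      ≡⟨ sumOf-lookup at-w (edges G) ⟩
    sumOf at-w (edges G)
      ≡⟨ sumOf-edges at-w ⟩
    sum (λ x → sum (λ y → ⟦ up x y ⟧ * (⟦ w == x ∨ w == y ⟧ * g x y)))
      ≡⟨ sum₂-cong endpoint ⟩
    sum (λ x → sum (λ y → ⟦ x == w ⟧ * h x y + ⟦ y == w ⟧ * h x y))
      ≡⟨ sum₂-distrib-+ (λ x y → ⟦ x == w ⟧ * h x y) _ ⟩
    sum (λ x → sum (λ y → ⟦ x == w ⟧ * h x y)) + sum (λ x → sum (λ y → ⟦ y == w ⟧ * h x y))
      ≡⟨ cong₂ _+_ (sum-cong-≗ (λ x → sym (*-distribˡ-sum ⟦ x == w ⟧ (h x)))) (sum-cong-≗ (λ x → sum-indicator w (h x))) ⟩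
    sum (λ x → ⟦ x == w ⟧ * sum (h x)) + sum (λ x → h x w)
      ≡⟨ cong (_+ sum (λ x → h x w)) (sum-indicator w (λ x → sum (h x))) ⟩
    sum (h w) + sum (λ x → h x w)
      ≡⟨ ∑-distrib-+ (h w) _ ⟨
    sum (λ y → h w y + h y w)
      ≡⟨ sum-cong-≗ (up-split g g-sym w) ⟩
    sum (λ y → ⟦ adjacency w y ⟧ * g w y)
      ∎
    where
    open ≡-Reasoning
    at-w : Fin n × Fin n → ℕ
    at-w (x , y) = ⟦ w == x ∨ w == y ⟧ * g x y
    h : Fin n → Fin n → ℕ
    h x y = ⟦ up x y ⟧ * g x y
    swap : ∀ p q r → p * (q * r) ≡ q * (p * r)
    swap = solve-∀
    endpoint : ∀ x y → ⟦ up x y ⟧ * (⟦ w == x ∨ w == y ⟧ * g x y) ≡ ⟦ x == w ⟧ * h x y + ⟦ y == w ⟧ * h x y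
    endpoint x y with w ≟ x | w ≟ y
    -- The right side would count a pair with both ends `w` twice, but `up w w` is false.
    ... | yes refl | yes refl rewrite ==-refl w | dec-false (w <? w) (Fin.<-irrefl refl) = refl
    ... | yes refl | no w≢y rewrite ==-refl w | ==-≢ (w≢y ∘ sym) =
      trans (swap ⟦ up w y ⟧ 1 (g w y)) (sym (+-identityʳ _))
    ... | no w≢x | yes refl rewrite ==-refl w | ==-≢ (w≢x ∘ sym) = swap ⟦ up x w ⟧ 1 (g x w)
    ... | no w≢x | no w≢y rewrite ==-≢ (w≢x ∘ sym) | ==-≢ (w≢y ∘ sym) = *-zeroʳ ⟦ up x y ⟧

-- Half-integral weights

fromℚᵘ-mono-≤ : ∀ {p q} → p ℚᵘ.≤ q → fromℚᵘ p ℚ.≤ fromℚᵘ q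
fromℚᵘ-mono-≤ {p} {q} p≤q = ℚ.toℚᵘ-cancel-≤ (begin
  toℚᵘ (fromℚᵘ p)  ≃⟨ ℚ.toℚᵘ-fromℚᵘ p ⟩
  p                ≤⟨ p≤q ⟩
  q                ≃⟨ ℚ.toℚᵘ-fromℚᵘ q ⟨
  toℚᵘ (fromℚᵘ q)  ∎)
  where open ℚᵘ.≤-Reasoning

-- This is `k / 2`: the second argument of `mkℚᵘ` is the denominator minus one.
half : ℕ → ℚ
half k = fromℚᵘ (mkℚᵘ (pos k) 1)

half-+ : ∀ k l → half k ℚ.+ half l ≡ half (k + l)
half-+ k l = ℚ.toℚᵘ-injective (begin-equality
  toℚᵘ (half k ℚ.+ half l)             ≃⟨ ℚ.toℚᵘ-homo-+ (half k) (half l) ⟩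
  toℚᵘ (half k) ℚᵘ.+ toℚᵘ (half l)     ≃⟨ ℚᵘ.+-cong (ℚ.toℚᵘ-fromℚᵘ (mkℚᵘ (pos k) 1)) (ℚ.toℚᵘ-fromℚᵘ (mkℚᵘ (pos l) 1)) ⟩
  mkℚᵘ (pos k) 1 ℚᵘ.+ mkℚᵘ (pos l) 1       ≃⟨ *≡* (common (pos k) (pos l)) ⟩
  mkℚᵘ (pos (k + l)) 1                   ≃⟨ ℚ.toℚᵘ-fromℚᵘ (mkℚᵘ (pos (k + l)) 1) ⟨
  toℚᵘ (half (k + l))                  ∎)
  where
  open ℚᵘ.≤-Reasoning
  common : ∀ p q → (p ℤ.* pos 2 ℤ.+ q ℤ.* pos 2) ℤ.* pos 2 ≡ (p ℤ.+ q) ℤ.* pos 4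
  common = ℤ-solve-∀

integer≤half : ∀ {a k} → a + a ≤ k → (pos a) ℚ./ 1 ℚ.≤ half k
integer≤half {a} {k} 2a≤k = fromℚᵘ-mono-≤ {mkℚᵘ (pos a) 0} {mkℚᵘ (pos k) 1} (*≤* (begin
  pos a ℤ.* pos 2   ≡⟨ ℤ.pos-* a 2 ⟨
  pos (a * 2)     ≤⟨ ℤ.+≤+ (subst₂ _≤_ (double a) (sym (*-identityʳ k)) 2a≤k) ⟩
  pos (k * 1)     ≡⟨ ℤ.pos-* k 1 ⟩
  pos k ℤ.* pos 1   ∎))
  where
  open ℤ.≤-Reasoning
  double : ∀ a → a + a ≡ a * 2
  double = solve-∀

half≤integer : ∀ {b k} → k ≤ b + b → half k ℚ.≤ (pos b) ℚ./ 1
half≤integer {b} {k} k≤2b = fromℚᵘ-mono-≤ {mkℚᵘ (pos k) 1} {mkℚᵘ (pos b) 0} (*≤* (begin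
  pos k ℤ.* pos 1   ≡⟨ ℤ.pos-* k 1 ⟨
  pos (k * 1)     ≤⟨ ℤ.+≤+ (subst₂ _≤_ (sym (*-identityʳ k)) (double b) k≤2b) ⟩
  pos (b * 2)     ≡⟨ ℤ.pos-* b 2 ⟩
  pos b ℤ.* pos 2   ∎))
  where
  open ℤ.≤-Reasoning
  double : ∀ b → b + b ≡ b * 2
  double = solve-∀

pointwise-≤ℝ : ∀ x y → (∀ i → seq x i ℚ.≤ seq y i) → x ≤ℝ y
pointwise-≤ℝ x y x≤y ε 0<ε = 0 , λ i _ → ℚ.≤-trans (x≤y i)
  (subst (ℚ._≤ seq y i ℚ.+ ε) (ℚ.+-identityʳ (seq y i)) (ℚ.+-monoʳ-≤ (seq y i) (ℚ.<⇒≤ 0<ε)))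

-- All summands are constant sequences, so the real sum is computed at each index by an addition of
-- naturals.
sumℝ-half : ∀ {X : Set} (k : X → ℕ) xs i → seq (sumℝ (map (λ x → fromℚ (half (k x))) xs)) i ≡ half (sumOf k xs)
sumℝ-half k []       i = refl
sumℝ-half k (x ∷ xs) i = trans (cong (half (k x) ℚ.+_) (sumℝ-half k xs i)) (half-+ (k x) _)

-- The weight at a vertex is the mean of its row sum and its column sum, and both lie between `a`
-- and `b`.
factor⇒fractional : ∀ {n} (G : Graph n) {a b} → Factor (adjacency G) a b → HasFractionalFactor G a b
factor⇒fractional {n} G {a} {b} F = (λ x → fromℚ (half (k x))) , bounds , weights
  where
  open Factor F
  g : Fin n → Fin n → ℕ
  g x y = ⟦ matrix x y ⟧ + ⟦ matrix y x ⟧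
  ends : Edge G → Fin n × Fin n
  ends = lookup (edges G)
  k : Edge G → ℕ
  k x = uncurry g (ends x)
  bounds : ∀ x → fromℕ 0 ≤ℝ fromℚ (half (k x)) × fromℚ (half (k x)) ≤ℝ fromℕ 1
  bounds x = pointwise-≤ℝ (fromℕ 0) (fromℚ (half (k x))) (λ _ → integer≤half {0} {k x} z≤n) ,
             pointwise-≤ℝ (fromℚ (half (k x))) (fromℕ 1) (λ _ → half≤integer {1} {k x} (+-mono-≤ (⟦⟧≤1 (matrix (proj₁ (ends x)) (proj₂ (ends x)))) (⟦⟧≤1 (matrix (proj₂ (ends x)) (proj₁ (ends x))))))
  incident-weight : ∀ w → sumOf k (filter (incident? G w) (allFin (e G))) ≡ row matrix w + col matrix w
  incident-weight w = begin
    sumOf k (filter (incident? G w) (allFin (e G)))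
      ≡⟨ incident-sum G g (λ x y → +-comm ⟦ matrix x y ⟧ _) w ⟩
    sum (λ y → ⟦ adjacency G w y ⟧ * g w y)
      ≡⟨ sum-cong-≗ inside-graph ⟩
    sum (g w)
      ≡⟨ ∑-distrib-+ (λ y → ⟦ matrix w y ⟧) _ ⟩
    row matrix w + col matrix w
      ∎
    where
    open ≡-Reasoning
    -- The matrix lies below the adjacency matrix, so `g w y` is already zero where `w` and `y` are
    -- not adjacent.
    inside-graph : ∀ y → ⟦ adjacency G w y ⟧ * g w y ≡ g w y
    inside-graph y with matrix w y in wy | matrix y w in yw
    ... | false | false = *-zeroʳ ⟦ adjacency G w y ⟧
    ... | true  | _     rewrite within w y wy = +-identityʳ _
    ... | false | true  rewrite adjacency-sym G w y | within y w yw = refl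
  weights : ∀ w → fromℕ a ≤ℝ weightAt G (λ x → fromℚ (half (k x))) w ×
                  weightAt G (λ x → fromℚ (half (k x))) w ≤ℝ fromℕ b
  weights w =
    pointwise-≤ℝ (fromℕ a) weight (λ i → subst ((pos a) ℚ./ 1 ℚ.≤_) (sym (weight≡ i))
      (integer≤half {a} (+-mono-≤ (a≤row w) (a≤col w)))) ,
    pointwise-≤ℝ weight (fromℕ b) (λ i → subst (ℚ._≤ (pos b) ℚ./ 1) (sym (weight≡ i))
      (half≤integer {b} (+-mono-≤ (row≤b w) (col≤b w))))
    where
    weight : ℝ
    weight = weightAt G (λ x → fromℚ (half (k x))) w
    weight≡ : ∀ i → seq weight i ≡ half (row matrix w + col matrix w)
    weight≡ i = trans (sumℝ-half k (filter (incident? G w) (allFin (e G))) i) (cong half (incident-weight w))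

-- Deleting an independent set

∈ᵇ : ∀ {n} → Subset n → Fin n → Bool
∈ᵇ I v = does (v ∈? I)

card-∈ : ∀ {n} (I : Subset n) → card (∈ᵇ I) ≡ ∣ I ∣
card-∈ []          = refl
card-∈ (true ∷ I)  = cong suc (card-∈ I)
card-∈ (false ∷ I) = card-∈ I

sum-outside : ∀ {n} (I : Subset n) (g : Fin n → ℕ) →
              sum (λ i → g (lookup (outside I) i)) ≡ sum (λ v → ⟦ not (∈ᵇ I v) ⟧ * g v)
sum-outside I g = trans (sumOf-lookup g (outside I)) (sumOf-filter-allFin (λ v → ¬? (v ∈? I)) g)

length-outside : ∀ {n} (I : Subset n) → length (outside I) + ∣ I ∣ ≡ n
length-outside {n} I = trans
  (cong₂ _+_ (length-filter-allFin (λ v → ¬? (v ∈? I))) (sym (card-∈ I)))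
  (card-complement (∈ᵇ I))

-- Induction by Pascal's rule. In the doubled form, with `n` on the left, neither division nor
-- truncated subtraction occurs.
2*[nC2]+n≡n*n : ∀ n → 2 * (n C 2) + n ≡ n * n
2*[nC2]+n≡n*n zero    = refl
2*[nC2]+n≡n*n (suc n) = begin
  2 * (suc n C 2) + suc n        ≡⟨ cong (λ c → 2 * c + suc n) (nCk+nC[k+1]≡[n+1]C[k+1] n 1) ⟨
  2 * (n C 1 + n C 2) + suc n    ≡⟨ cong (λ c → 2 * (c + n C 2) + suc n) (nC1≡n n) ⟩
  2 * (n + n C 2) + suc n        ≡⟨ regroup n (n C 2) ⟩
  (2 * (n C 2) + n) + (1 + 2 * n) ≡⟨ cong (_+ (1 + 2 * n)) (2*[nC2]+n≡n*n n) ⟩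
  n * n + (1 + 2 * n)            ≡⟨ square n ⟩
  suc n * suc n                  ∎
  where
  open ≡-Reasoning
  regroup : ∀ n c → 2 * (n + c) + suc n ≡ (2 * c + n) + (1 + 2 * n)
  regroup = solve-∀
  square : ∀ n → n * n + (1 + 2 * n) ≡ suc n * suc n
  square = solve-∀

module _ {n : ℕ} (G : Graph n) (I : Subset n) where
  private
    A : Matrix n
    A = adjacency G
    m : ℕ
    m = length (outside I)
    in-I out-I : Fin n → ℕ
    in-I v = ⟦ ∈ᵇ I v ⟧
    out-I v = ⟦ not (∈ᵇ I v) ⟧

    sum-in : sum in-I ≡ ∣ I ∣
    sum-in = card-∈ I

    sum-out : sum out-I ≡ m
    sum-out = sym (length-filter-allFin (λ v → ¬? (v ∈? I)))

  row-restrict : ∀ x → row A x ≤ sum (λ v → out-I v * ⟦ A x v ⟧) + ∣ I ∣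
  row-restrict x = begin
    row A x                                            ≤⟨ sum-mono-≤ (λ v → split (∈ᵇ I v) (A x v)) ⟩
    sum (λ v → out-I v * ⟦ A x v ⟧ + in-I v)           ≡⟨ ∑-distrib-+ (λ v → out-I v * ⟦ A x v ⟧) _ ⟩
    sum (λ v → out-I v * ⟦ A x v ⟧) + sum in-I         ≡⟨ cong (sum (λ v → out-I v * ⟦ A x v ⟧) +_) sum-in ⟩
    sum (λ v → out-I v * ⟦ A x v ⟧) + ∣ I ∣            ∎
    where
    open ≤-Reasoning
    split : ∀ c e → ⟦ e ⟧ ≤ ⟦ not c ⟧ * ⟦ e ⟧ + ⟦ c ⟧
    split true  true  = ≤-refl
    split true  false = z≤n
    split false true  = ≤-refl
    split false false = z≤n

  -- A remaining vertex loses at most one neighbour for each element of `I`.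
  row-delete : ∀ {a} → δ G ≥ a + ∣ I ∣ → ∀ i → a ≤ row (adjacency (G - I)) i
  row-delete {a} δ≥ i = +-cancelʳ-≤ ∣ I ∣ _ _ (begin
    a + ∣ I ∣                                                     ≤⟨ δ≥ ⟩
    δ G                                                           ≤⟨ δ≤row G (lookup (outside I) i) ⟩
    row A (lookup (outside I) i)                             ≤⟨ row-restrict (lookup (outside I) i) ⟩
    sum (λ v → out-I v * ⟦ A (lookup (outside I) i) v ⟧) + ∣ I ∣
      ≡⟨ cong (_+ ∣ I ∣) (sum-outside I (λ v → ⟦ A (lookup (outside I) i) v ⟧)) ⟨
    row (adjacency (G - I)) i + ∣ I ∣                             ∎)
    where open ≤-Reasoning

  -- Independence leaves no arc inside `I`, so each lost arc joins `I` to its complement, and there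
  -- are `2 * (∣ I ∣ * m)` such ordered pairs.
  total-delete : Independent G I → total A ≤ total (adjacency (G - I)) + 2 * (∣ I ∣ * m)
  total-delete independent = begin
    total A
      ≤⟨ sum₂-mono pointwise ⟩
    sum (λ x → sum (λ v → out-I x * (out-I v * ⟦ A x v ⟧) + (in-I x * out-I v + out-I x * in-I v)))
      ≡⟨ sum₂-distrib-+ (λ x v → out-I x * (out-I v * ⟦ A x v ⟧)) _ ⟩
    sum (λ x → sum (λ v → out-I x * (out-I v * ⟦ A x v ⟧))) +
    sum (λ x → sum (λ v → in-I x * out-I v + out-I x * in-I v))
      ≡⟨ cong₂ _+_ inner (sum₂-distrib-+ (λ x v → in-I x * out-I v) _) ⟩
    total (adjacency (G - I)) +
    (sum (λ x → sum (λ v → in-I x * out-I v)) + sum (λ x → sum (λ v → out-I x * in-I v)))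
      ≡⟨ cong (total (adjacency (G - I)) +_) (cong₂ _+_
           (trans (sum₂-product in-I out-I) (cong₂ _*_ sum-in sum-out))
           (trans (sum₂-product out-I in-I) (cong₂ _*_ sum-out sum-in))) ⟩
    total (adjacency (G - I)) + (∣ I ∣ * m + m * ∣ I ∣)
      ≡⟨ cong (total (adjacency (G - I)) +_) (double ∣ I ∣ m) ⟩
    total (adjacency (G - I)) + 2 * (∣ I ∣ * m)
      ∎
    where
    open ≤-Reasoning
    double : ∀ p q → p * q + q * p ≡ 2 * (p * q)
    double = solve-∀
    inner : sum (λ x → sum (λ v → out-I x * (out-I v * ⟦ A x v ⟧))) ≡ total (adjacency (G - I))
    inner = trans
      (sum-cong-≗ λ x → trans (sym (*-distribˡ-sum (out-I x) (λ v → out-I v * ⟦ A x v ⟧)))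
                              (cong (out-I x *_) (sym (sum-outside I (λ v → ⟦ A x v ⟧)))))
      (sym (sum-outside I (λ x → sum (λ j → ⟦ A x (lookup (outside I) j) ⟧))))
    pointwise : ∀ x v → ⟦ A x v ⟧ ≤ out-I x * (out-I v * ⟦ A x v ⟧) + (in-I x * out-I v + out-I x * in-I v)
    pointwise x v with x ∈? I | v ∈? I
    ... | yes x∈I | yes v∈I rewrite dec-false (Graph._∼?_ G x v) (independent x∈I v∈I) = z≤n
    ... | yes _   | no _    = ⟦⟧≤1 (A x v)
    ... | no _    | yes _   = ⟦⟧≤1 (A x v)
    ... | no _    | no _    = ≤-reflexive (unit ⟦ A x v ⟧)
      where
      unit : ∀ z → z ≡ 1 * (1 * z) + 0
      unit = solve-∀

theorem1p9 : ∀ (a b r n : ℕ) → r ≥ 1 → b ≥ a → a ≥ 1 →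
    (G : Graph n) → Connected G →
    n ≥ 4 * (a + b + r + 1) →
    δ G ≥ a + r →
    e G ≥ ((n ∸ r ∸ b ∸ 1) C 2) + r * (n ∸ r) + a * (b + 1) + a →
    FractionalIDCritical a b r G
theorem1p9 a b r n r≥1 b≥a _ G _ n≥ δ≥ e≥ I independent refl =
  factor⇒fractional (G - I) (hall⇒factor A (adjacency-sym (G - I)) b≥a
    (dense⇒hall A (adjacency-sym (G - I)) (adjacency-irrefl (G - I)) b≥a (row-delete G I δ≥) large dense))
  where
  m : ℕ
  m = length (outside I)
  A : Matrix m
  A = adjacency (G - I)
  m+r≡n : m + r ≡ n
  m+r≡n = length-outside I
  -- Removing `r` vertices leaves at least `4 a + 4 b + 3 r + 4`, and `r ≥ 1` turns `3 r + 4` into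
  -- at least 7.
  large : 4 * a + 4 * b + 7 ≤ m
  large = +-cancelʳ-≤ r _ _ (begin
    4 * a + 4 * b + 7 + r              ≡⟨ regroup a b r ⟩
    4 * a + 4 * b + r + 4 + 3 * 1      ≤⟨ +-monoʳ-≤ (4 * a + 4 * b + r + 4) (*-monoʳ-≤ 3 r≥1) ⟩
    4 * a + 4 * b + r + 4 + 3 * r      ≡⟨ regroup′ a b r ⟩
    4 * (a + b + r + 1)                ≤⟨ n≥ ⟩
    n                                  ≡⟨ m+r≡n ⟨
    m + r                              ∎)
    where
    open ≤-Reasoning
    regroup : ∀ a b r → 4 * a + 4 * b + 7 + r ≡ 4 * a + 4 * b + r + 4 + 3 * 1
    regroup = solve-∀
    regroup′ : ∀ a b r → 4 * a + 4 * b + r + 4 + 3 * r ≡ 4 * (a + b + r + 1)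
    regroup′ = solve-∀
  n∸r≡m : n ∸ r ≡ m
  n∸r≡m = trans (cong (_∸ r) (sym m+r≡n)) (m+n∸n≡m m r)
  -- Twice the hypothesis on `e G`, read through the handshake identity. The term `r * (n ∸ r)` pays
  -- exactly for the arcs that may be lost with `I`, and `a (b + 1) + a` is `a (b + 2)`.
  dense : ∀ M → m ≡ suc b + M → M * M + 2 * (a * (b + 2)) ≤ total A + M
  dense M m≡ = +-cancelʳ-≤ (2 * (r * m)) _ _ (begin
    M * M + 2 * (a * (b + 2)) + 2 * (r * m)
      ≡⟨ cong (λ z → z + 2 * (a * (b + 2)) + 2 * (r * m)) (2*[nC2]+n≡n*n M) ⟨
    2 * (M C 2) + M + 2 * (a * (b + 2)) + 2 * (r * m)
      ≡⟨ regroup (M C 2) a b (r * m) M ⟩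
    2 * ((M C 2) + r * m + a * (b + 1) + a) + M
      ≡⟨ cong₂ (λ k l → 2 * ((k C 2) + r * l + a * (b + 1) + a) + M) order n∸r≡m ⟨
    2 * (((n ∸ r ∸ b ∸ 1) C 2) + r * (n ∸ r) + a * (b + 1) + a) + M
      ≤⟨ +-monoˡ-≤ M (*-monoʳ-≤ 2 e≥) ⟩
    2 * e G + M
      ≡⟨ cong (_+ M) (handshake G) ⟩
    total (adjacency G) + M
      ≤⟨ +-monoˡ-≤ M (total-delete G I independent) ⟩
    total A + 2 * (r * m) + M
      ≡⟨ swap-last (total A) (2 * (r * m)) M ⟩
    total A + M + 2 * (r * m)
      ∎)
    where
    open ≤-Reasoning
    order : n ∸ r ∸ b ∸ 1 ≡ M
    order = trans (cong (λ z → z ∸ b ∸ 1) (trans n∸r≡m m≡))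
      (cong (_∸ 1) (trans (cong (_∸ b) (sym (+-suc b M))) (m+n∸m≡n b (suc M))))
    regroup : ∀ c a b l M → 2 * c + M + 2 * (a * (b + 2)) + 2 * l ≡ 2 * (c + l + a * (b + 1) + a) + M
    regroup = solve-∀
    swap-last : ∀ i j k → i + j + k ≡ i + k + j
    swap-last = solve-∀
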